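{- Let $r\geq 2$ and $n\geq m\geq 1$ be integers such that $n+m+2\geq \frac{(\lceil r/2\rceil+1)^2}{2}$. Then $$\widehat{R}_r(S_{n,m})\leq 4r^2nm+2r(n+m)+1.$$ Moreover, if $r=2$ then $\widehat{R}_r(S_{n,m})\geq \frac{1}{2}(m+1)(n+m+2)$, and if $r\geq 3$ then $\widehat{R}_r(S_{n,m})\geq \frac{r^2-1}{16}m(n+m+2)$.
   Context: Graphs are finite and simple. The $r$-color size-Ramsey number $\widehat{R}_r(H)$ of a graph $H$ is the minimum number of edges in a graph $G$ having the property that every $r$-coloring of the edges of $G$ contains a monochromatic copy of $H$ (as a not necessarily induced subgraph). The double star $S_{n,m}$ is the tree on $n+m+2$ vertices obtained from vertex-disjoint copies of $K_{1,n}$ and $K_{1,m}$ by joining their centers with an edge. -}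

module Defs where

open import Data.Bool.Base using (Bool; true; false; T)
open import Data.Bool.Properties using (T?)
open import Data.Fin.Base using (Fin; zero; suc; splitAt)
open import Data.Fin.Properties using (_<?_)
open import Data.List.Base using (List; allFin; cartesianProduct; filter; length)
open import Data.Nat.Base using (ℕ; _+_; _≤_)
open import Data.Nat.Properties using (≤-antisym)
open import Data.Product.Base using (Σ; ∃; _×_; _,_)
open import Data.Sum.Base using (_⊎_; inj₁; inj₂)
open import Function.Definitions using (Injective)
open import Relation.Nullary.Decidable using (_×-dec_)
open import Relation.Binary.PropositionalEquality using (_≡_; refl)

record Graph : Set where
  field
    order      : ℕ
    adj        : Fin order → Fin order → Bool
    adj-sym    : ∀ u v → adj u v ≡ adj v u
    adj-irrefl : ∀ v → adj v v ≡ false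

  Vertex : Set
  Vertex = Fin order

  -- Proof-irrelevant, so an edge is determined by its endpoints.
  Adj : Vertex → Vertex → Set
  Adj u v = T (adj u v)

  -- Each undirected edge is listed once, with its smaller endpoint first.
  edges : List (Vertex × Vertex)
  edges = filter (λ (u , v) → u <? v ×-dec T? (adj u v))
                 (cartesianProduct (allFin order) (allFin order))

  size : ℕ
  size = length edges

open Graph public

-- A function on ordered adjacent pairs that agrees on the two orientations
-- of each edge, i.e. a function on undirected edges.
record EdgeColouring (r : ℕ) (G : Graph) : Set where
  field
    colour     : ∀ u v → Adj G u v → Fin r
    colour-sym : ∀ u v (e : Adj G u v) (e′ : Adj G v u) →
                 colour u v e ≡ colour v u e′

open EdgeColouring public

record MonochromaticCopy {r : ℕ} {G : Graph}
                         (c : EdgeColouring r G) (H : Graph) : Set where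
  field
    copyColour : Fin r
    embed      : Vertex H → Vertex G
    embed-inj  : Injective _≡_ _≡_ embed
    embed-edge : ∀ u v → Adj H u v →
                 Σ (Adj G (embed u) (embed v)) λ e →
                   colour c (embed u) (embed v) e ≡ copyColour

-- G → (H)ᵣ
Arrows : ℕ → Graph → Graph → Set
Arrows r G H = (c : EdgeColouring r G) → MonochromaticCopy c H

-- k is the minimum of { size G : G → (H)ᵣ }.
IsSizeRamseyNumber : ℕ → Graph → ℕ → Set
IsSizeRamseyNumber r H k =
  (∃ λ G → Arrows r G H × size G ≡ k) ×
  (∀ G → Arrows r G H → k ≤ size G)

isSizeRamseyNumber-unique : ∀ {r H k l} →
  IsSizeRamseyNumber r H k → IsSizeRamseyNumber r H l → k ≡ l
isSizeRamseyNumber-unique ((G , G→H , refl) , k-min) ((G′ , G′→H , refl) , l-min) =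
  ≤-antisym (k-min G′ G′→H) (l-min G G→H)

-- The star K₁,ₙ, with centre zero.
starAdj : ∀ {n} → Fin (1 + n) → Fin (1 + n) → Bool
starAdj zero    zero    = false
starAdj zero    (suc _) = true
starAdj (suc _) zero    = true
starAdj (suc _) (suc _) = false

starAdj-sym : ∀ {n} (a b : Fin (1 + n)) → starAdj a b ≡ starAdj b a
starAdj-sym zero    zero    = refl
starAdj-sym zero    (suc _) = refl
starAdj-sym (suc _) zero    = refl
starAdj-sym (suc _) (suc _) = refl

starAdj-irrefl : ∀ {n} (a : Fin (1 + n)) → starAdj a a ≡ false
starAdj-irrefl zero    = refl
starAdj-irrefl (suc _) = refl

areCentres : ∀ {n m} → Fin (1 + n) → Fin (1 + m) → Bool
areCentres zero    zero    = true
areCentres zero    (suc _) = false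
areCentres (suc _) _       = false

doubleStarAdj : ∀ {n m} (x y : Fin (1 + n) ⊎ Fin (1 + m)) → Bool
doubleStarAdj (inj₁ a) (inj₁ b) = starAdj a b
doubleStarAdj (inj₁ a) (inj₂ b) = areCentres a b
doubleStarAdj (inj₂ a) (inj₁ b) = areCentres b a
doubleStarAdj (inj₂ a) (inj₂ b) = starAdj a b

doubleStarAdj-sym : ∀ {n m} (x y : Fin (1 + n) ⊎ Fin (1 + m)) →
                    doubleStarAdj x y ≡ doubleStarAdj y x
doubleStarAdj-sym (inj₁ a) (inj₁ b) = starAdj-sym a b
doubleStarAdj-sym (inj₁ a) (inj₂ b) = refl
doubleStarAdj-sym (inj₂ a) (inj₁ b) = refl
doubleStarAdj-sym (inj₂ a) (inj₂ b) = starAdj-sym a b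

doubleStarAdj-irrefl : ∀ {n m} (x : Fin (1 + n) ⊎ Fin (1 + m)) →
                       doubleStarAdj x x ≡ false
doubleStarAdj-irrefl (inj₁ a) = starAdj-irrefl a
doubleStarAdj-irrefl (inj₂ a) = starAdj-irrefl a

-- Sₙ,ₘ: the first 1 + n vertices carry K₁,ₙ, the last 1 + m carry K₁,ₘ, and
-- the two centres are joined.
doubleStar : ℕ → ℕ → Graph
doubleStar n m = record
  { order      = (1 + n) + (1 + m)
  ; adj        = λ u v → doubleStarAdj (splitAt (1 + n) u) (splitAt (1 + n) v)
  ; adj-sym    = λ u v → doubleStarAdj-sym (splitAt (1 + n) u) (splitAt (1 + n) v)
  ; adj-irrefl = λ v → doubleStarAdj-irrefl (splitAt (1 + n) v)
  }

{-# OPTIONS --safe #-}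

-- Upper bound. In an r-coloured K₁₊₂ᵣₙ,₁₊₂ᵣₘ without a monochromatic Sₙ,ₘ, every
-- edge has, in its own colour, degree at most m at its left end or at most n at
-- its right end, which accounts for fewer edges than there are. The minimum
-- exists constructively since arrowing is decidable and a graph of size s has at
-- most 2s non-isolated vertices.
--
-- Lower bound. Put t = ⌊r/4⌋ and split the colours as r = p + q with p = 1 + 2t.
-- If G is small, it has few big vertices, those of degree above q m. They are
-- divided into 2 + 2t parts, any two with fewer than n + m + 2 vertices together,
-- and the edges between them are coloured with the first p colours along a
-- 1-factorisation of the parts, so no colour contains Sₙ,ₘ. The other edges are
-- coloured greedily such that a small vertex has degree at most m in every
-- colour and an edge joining a small to a big vertex gets one of the last q
-- colours. Both centres of a monochromatic Sₙ,ₘ are then big, hence so are its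
-- leaves, which is impossible. For r = 2 take p = q = 1 and a single part.
module Submission where

open import Defs
open import Data.Bool.Base using (Bool; true; false; T; not; _∧_; if_then_else_)
open import Data.Bool.Properties using (T?; T-irrelevant)
open import Data.Fin.Base
  using (Fin; zero; suc; toℕ; fromℕ<; inject≤; _↑ˡ_; _↑ʳ_; splitAt; join; punchIn; combine; remQuot)
import Data.Fin.Base as Fin using (_<_)
import Data.Fin.Properties as Fin
open import Data.List.Base using (List; []; _∷_; allFin; cartesianProduct; filter; length; lookup; map)
open import Data.List.Membership.Propositional using (_∈_; find; lose)
open import Data.List.Membership.Propositional.Properties
  using (∈-allFin; ∈-cartesianProduct⁺; ∈-filter⁺; ∈-filter⁻; ∈-lookup; ∈-map⁺; ∈-map⁻)
open import Data.List.Membership.Setoid.Properties using (index-injective)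
open import Data.List.Properties using (length-map; length-tabulate)
import Data.List.Relation.Unary.All as All
open import Data.List.Relation.Unary.AllPairs using ([]; _∷_)
open import Data.List.Relation.Unary.Any using (here; there; index; any?)
open import Data.List.Relation.Unary.Any.Properties using (lookup-index)
open import Data.List.Relation.Unary.Unique.Propositional using (Unique)
import Data.List.Relation.Unary.Unique.Propositional.Properties as Unique
open import Data.Nat.Base
  using (ℕ; zero; suc; _+_; _*_; _∸_; _^_; _≤_; _<_; z≤n; s≤s; s≤s⁻¹; ⌊_/2⌋; ⌈_/2⌉; NonZero)
open import Data.Nat.DivMod
  using (_%_; _mod_; _divMod_; result; m<n⇒m%n≡m; %-distribˡ-+; %-distribˡ-*; [m+n]%n≡m%n; [m+kn]%n≡m%n)
open import Data.Nat.Properties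
open import Data.Nat.Tactic.RingSolver using (solve-∀)
open import Data.Product.Base using (Σ; ∃; ∃-syntax; _×_; _,_; proj₁; proj₂)
open import Data.Product.Properties using (,-injective; ≡-dec)
open import Data.Sum.Base as Sum using (_⊎_; inj₁; inj₂)
open import Data.Unit.Base using (tt)
open import Data.Vec.Base as Vec using (Vec; []; _∷_; tabulate)
open import Data.Vec.Properties using (lookup∘tabulate)
open import Function.Base using (_∘_; id)
open import Function.Definitions using (Injective)
open import Relation.Binary.Definitions using (tri<; tri≈; tri>)
open import Relation.Binary.PropositionalEquality hiding ([_])
open import Relation.Nullary.Decidable
  using (Dec; yes; no; does; map′; decidable-stable; dec-true; dec-false; _×-dec_; _⊎-dec_; _→-dec_; ¬?)
open import Relation.Nullary.Negation using (¬_; contradiction)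
open import Relation.Unary using (Decidable)

-- Finite sums and counting

𝟙 : {P : Set} → Dec P → ℕ
𝟙 d = if does d then 1 else 0

𝟙-yes : {P : Set} (d : Dec P) → P → 𝟙 d ≡ 1
𝟙-yes (yes _) _ = refl
𝟙-yes (no ¬p) p = contradiction p ¬p

𝟙-no : {P : Set} (d : Dec P) → ¬ P → 𝟙 d ≡ 0
𝟙-no (yes p) ¬p = contradiction p ¬p
𝟙-no (no _)  _  = refl

𝟙-⊎ : {P Q R : Set} (d : Dec P) (e : Dec Q) (f : Dec R) →
      (P → Q ⊎ R) → 𝟙 d ≤ 𝟙 e + 𝟙 f
𝟙-⊎ (no _)  e f P⇒Q⊎R = z≤n
𝟙-⊎ (yes p) e f P⇒Q⊎R with P⇒Q⊎R p
... | inj₁ q = ≤-trans (≤-reflexive (sym (𝟙-yes e q))) (m≤m+n _ _)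
... | inj₂ r = ≤-trans (≤-reflexive (sym (𝟙-yes f r))) (m≤n+m _ _)

∑ : {A : Set} → List A → (A → ℕ) → ℕ
∑ []       f = 0
∑ (x ∷ xs) f = f x + ∑ xs f

∑-mono : {A : Set} (xs : List A) {f g : A → ℕ} →
         (∀ {x} → x ∈ xs → f x ≤ g x) → ∑ xs f ≤ ∑ xs g
∑-mono []       f≤g = z≤n
∑-mono (x ∷ xs) f≤g = +-mono-≤ (f≤g (here refl)) (∑-mono xs (f≤g ∘ there))

∑-cong : {A : Set} (xs : List A) {f g : A → ℕ} →
         (∀ {x} → x ∈ xs → f x ≡ g x) → ∑ xs f ≡ ∑ xs g
∑-cong []       f≡g = refl
∑-cong (x ∷ xs) f≡g = cong₂ _+_ (f≡g (here refl)) (∑-cong xs (f≡g ∘ there))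

∑-+ : {A : Set} (xs : List A) (f g : A → ℕ) →
      ∑ xs (λ x → f x + g x) ≡ ∑ xs f + ∑ xs g
∑-+ []       f g = refl
∑-+ (x ∷ xs) f g =
  trans (cong (f x + g x +_) (∑-+ xs f g)) (+-interchange (f x) (g x) _ _)
  where
  open import Algebra.Properties.CommutativeSemigroup +-commutativeSemigroup
    renaming (interchange to +-interchange)

∑-const : {A : Set} (xs : List A) (c : ℕ) → ∑ xs (λ _ → c) ≡ length xs * c
∑-const []       c = refl
∑-const (x ∷ xs) c = cong (c +_) (∑-const xs c)

∑-*ʳ : {A : Set} (xs : List A) (f : A → ℕ) (c : ℕ) →
       ∑ xs (λ x → f x * c) ≡ ∑ xs f * c
∑-*ʳ []       f c = refl
∑-*ʳ (x ∷ xs) f c =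
  trans (cong (f x * c +_) (∑-*ʳ xs f c)) (sym (*-distribʳ-+ c (f x) (∑ xs f)))

∑-swap : {A B : Set} (xs : List A) (ys : List B) (f : A → B → ℕ) →
         ∑ xs (λ x → ∑ ys (f x)) ≡ ∑ ys (λ y → ∑ xs (λ x → f x y))
∑-swap []       ys f = sym (trans (∑-const ys 0) (*-zeroʳ (length ys)))
∑-swap (x ∷ xs) ys f =
  trans (cong (∑ ys (f x) +_) (∑-swap xs ys f)) (sym (∑-+ ys (f x) _))

term≤∑ : {A : Set} {xs : List A} (f : A → ℕ) {x : A} → x ∈ xs → f x ≤ ∑ xs f
term≤∑ f (here refl)  = m≤m+n _ _
term≤∑ f (there x∈xs) = ≤-trans (term≤∑ f x∈xs) (m≤n+m _ _)

count : {A : Set} {P : A → Set} → Decidable P → List A → ℕ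
count P? xs = ∑ xs (λ x → 𝟙 (P? x))

length-filter : {A : Set} {P : A → Set} (P? : Decidable P) (xs : List A) →
                length (filter P? xs) ≡ count P? xs
length-filter P? [] = refl
length-filter P? (x ∷ xs) with does (P? x)
... | true  = cong suc (length-filter P? xs)
... | false = length-filter P? xs

count-none : {A : Set} {P : A → Set} (P? : Decidable P) (xs : List A) →
             (∀ {x} → x ∈ xs → ¬ P x) → count P? xs ≡ 0
count-none P? xs none = begin
  count P? xs         ≡⟨ ∑-cong xs (λ {x} x∈xs → 𝟙-no (P? x) (none x∈xs)) ⟩
  ∑ xs (λ _ → 0)      ≡⟨ ∑-const xs 0 ⟩
  length xs * 0       ≡⟨ *-zeroʳ (length xs) ⟩
  0                   ∎
  where open ≡-Reasoning

count≤1 : {A : Set} {P : A → Set} (P? : Decidable P) {xs : List A} → Unique xs →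
          (∀ {x y} → P x → P y → x ≡ y) → count P? xs ≤ 1
count≤1 P? []               P-prop = z≤n
count≤1 P? {x ∷ xs} (x∉xs ∷ xs!) P-prop with P? x
... | no  _  = count≤1 P? xs! P-prop
... | yes px = ≤-reflexive (cong suc
  (count-none P? xs (λ y∈xs py → All.lookup x∉xs y∈xs (P-prop px py))))

length-allFin : ∀ n → length (allFin n) ≡ n
length-allFin n = length-tabulate {n = n} id

-- The positions of the values `f j` in `xs` are pairwise distinct.
injection⇒≤length : ∀ {A : Set} {k} {xs : List A} (f : Fin k → A) → Injective _≡_ _≡_ f →
                    (∀ j → f j ∈ xs) → k ≤ length xs
injection⇒≤length f f-inj f∈xs =
  Fin.injective⇒≤ {f = index ∘ f∈xs}
    (λ {i} {j} eq → f-inj (index-injective (setoid _) (f∈xs i) (f∈xs j) eq))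

injection⇒≤count : ∀ {A : Set} {P : A → Set} (P? : Decidable P) {k} {xs : List A}
                   (f : Fin k → A) → Injective _≡_ _≡_ f →
                   (∀ j → f j ∈ xs) → (∀ j → P (f j)) → k ≤ count P? xs
injection⇒≤count P? {xs = xs} f f-inj f∈xs Pf =
  ≤-trans (injection⇒≤length f f-inj (λ j → ∈-filter⁺ P? (f∈xs j) (Pf j)))
          (≤-reflexive (length-filter P? xs))

lookup-injective : ∀ {A : Set} {xs : List A} → Unique xs → Injective _≡_ _≡_ (lookup xs)
lookup-injective (x∉xs ∷ xs!) {zero}  {zero}  eq = refl
lookup-injective {xs = _ ∷ xs} (x∉xs ∷ xs!) {zero}  {suc j} eq =
  contradiction eq (All.lookup x∉xs (∈-lookup {xs = xs} j))
lookup-injective {xs = _ ∷ xs} (x∉xs ∷ xs!) {suc i} {zero}  eq =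
  contradiction (sym eq) (All.lookup x∉xs (∈-lookup {xs = xs} i))
lookup-injective (x∉xs ∷ xs!) {suc i} {suc j} eq = cong suc (lookup-injective xs! eq)

count⇒injection : ∀ {A : Set} {P : A → Set} (P? : Decidable P) {k} {xs : List A} →
                  Unique xs → k ≤ count P? xs →
                  Σ (Fin k → A) λ f → Injective _≡_ _≡_ f × (∀ j → P (f j))
count⇒injection {A} P? {k} {xs} xs! k≤ = f , f-inj , λ j → proj₂ (∈-filter⁻ P? {xs = xs} (∈-lookup _))
  where
  k≤length : k ≤ length (filter P? xs)
  k≤length = ≤-trans k≤ (≤-reflexive (sym (length-filter P? xs)))
  f : Fin k → A
  f j = lookup (filter P? xs) (inject≤ j k≤length)
  f-inj : Injective _≡_ _≡_ f
  f-inj eq = Fin.inject≤-injective k≤length k≤length _ _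
               (lookup-injective (Unique.filter⁺ P? xs!) eq)

-- Each of the r values accounts for at most m of the counted elements.
count-rare≤ : ∀ {A : Set} {r} (f : A → Fin r) (m : ℕ) (xs : List A) →
              count (λ x → count (λ y → f y Fin.≟ f x) xs ≤? m) xs ≤ r * m
count-rare≤ {A} {r} f m xs = begin
  count (λ x → mult (f x) ≤? m) xs
    ≤⟨ ∑-mono xs (λ {x} _ → split x) ⟩
  ∑ xs (λ x → ∑ (allFin r) (λ i → 𝟙 (f x Fin.≟ i) * 𝟙 (mult i ≤? m)))
    ≡⟨ ∑-swap xs (allFin r) _ ⟩
  ∑ (allFin r) (λ i → ∑ xs (λ x → 𝟙 (f x Fin.≟ i) * 𝟙 (mult i ≤? m)))
    ≤⟨ ∑-mono (allFin r) (λ {i} _ → few i) ⟩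
  ∑ (allFin r) (λ _ → m)
    ≡⟨ ∑-const (allFin r) m ⟩
  length (allFin r) * m
    ≡⟨ cong (_* m) (length-allFin r) ⟩
  r * m ∎
  where
  open ≤-Reasoning
  mult : Fin r → ℕ
  mult i = count (λ y → f y Fin.≟ i) xs
  split : ∀ x → 𝟙 (mult (f x) ≤? m) ≤
                ∑ (allFin r) (λ i → 𝟙 (f x Fin.≟ i) * 𝟙 (mult i ≤? m))
  split x = begin
    𝟙 (mult (f x) ≤? m)
      ≡⟨ *-identityˡ _ ⟨
    1 * 𝟙 (mult (f x) ≤? m)
      ≡⟨ cong (_* 𝟙 (mult (f x) ≤? m)) (𝟙-yes (f x Fin.≟ f x) refl) ⟨
    𝟙 (f x Fin.≟ f x) * 𝟙 (mult (f x) ≤? m)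
      ≤⟨ term≤∑ (λ i → 𝟙 (f x Fin.≟ i) * 𝟙 (mult i ≤? m)) (∈-allFin (f x)) ⟩
    ∑ (allFin r) (λ i → 𝟙 (f x Fin.≟ i) * 𝟙 (mult i ≤? m)) ∎
  -- After factoring, the sum is `mult i` times the indicator of `mult i ≤ m`: it is `mult i` if
  -- that is at most m, and 0 otherwise.
  few : ∀ i → ∑ xs (λ x → 𝟙 (f x Fin.≟ i) * 𝟙 (mult i ≤? m)) ≤ m
  few i = ≤-trans (≤-reflexive (∑-*ʳ xs (λ x → 𝟙 (f x Fin.≟ i)) _)) (cap (mult i ≤? m))
    where
    cap : ∀ {k} (d : Dec (k ≤ m)) → k * 𝟙 d ≤ m
    cap (yes k≤m) = ≤-trans (≤-reflexive (*-identityʳ _)) k≤m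
    cap {k} (no _) = ≤-trans (≤-reflexive (*-zeroʳ k)) z≤n

-- Edges and degrees

-- Unordered pairs, listed as in `edges`.
ordered : ∀ {N} → Fin N → Fin N → Fin N × Fin N
ordered u v with u Fin.<? v
... | yes _ = u , v
... | no  _ = v , u

ordered-< : ∀ {N} {u v : Fin N} → u Fin.< v → ordered u v ≡ (u , v)
ordered-< {u = u} {v} u<v with u Fin.<? v
... | yes _  = refl
... | no u≮v = contradiction u<v u≮v

ordered-> : ∀ {N} {u v : Fin N} → v Fin.< u → ordered u v ≡ (v , u)
ordered-> {u = u} {v} v<u with u Fin.<? v
... | yes u<v = contradiction v<u (<-asym u<v)
... | no  _   = refl

ordered-sym : ∀ {N} (u v : Fin N) → ordered u v ≡ ordered v u
ordered-sym u v with Fin.<-cmp u v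
... | tri< u<v _ _ = trans (ordered-< u<v) (sym (ordered-> u<v))
... | tri≈ _ refl _ = refl
... | tri> _ _ v<u = trans (ordered-> v<u) (sym (ordered-< v<u))

ordered-cases : ∀ {N} (u v : Fin N) → ordered u v ≡ (u , v) ⊎ ordered u v ≡ (v , u)
ordered-cases u v with u Fin.<? v
... | yes _ = inj₁ refl
... | no  _ = inj₂ refl

ordered-injective : ∀ {N} {u v u′ v′ : Fin N} → ordered u v ≡ ordered u′ v′ →
                    (u ≡ u′ × v ≡ v′) ⊎ (u ≡ v′ × v ≡ u′)
ordered-injective {u = u} {v} {u′} {v′} eq with ordered-cases u v | ordered-cases u′ v′
... | inj₁ p | inj₁ q = inj₁ (,-injective (trans (sym p) (trans eq q)))
... | inj₁ p | inj₂ q = inj₂ (,-injective (trans (sym p) (trans eq q)))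
... | inj₂ p | inj₁ q with refl ← trans (sym p) (trans eq q) = inj₂ (refl , refl)
... | inj₂ p | inj₂ q with refl ← trans (sym p) (trans eq q) = inj₁ (refl , refl)

Adj-sym : ∀ G {u v} → Adj G u v → Adj G v u
Adj-sym G {u} {v} = subst T (adj-sym G u v)

Adj⇒≢ : ∀ G {u v} → Adj G u v → u ≢ v
Adj⇒≢ G {u} e refl = subst T (adj-irrefl G u) e

∈-edges⁻ : ∀ G {u v} → (u , v) ∈ edges G → u Fin.< v × Adj G u v
∈-edges⁻ G e∈ = proj₂ (∈-filter⁻ (λ (u , v) → u Fin.<? v ×-dec T? (adj G u v))
  {xs = cartesianProduct (allFin (order G)) (allFin (order G))} e∈)

∈-edges⁺ : ∀ G {u v} → Adj G u v → ordered u v ∈ edges G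
∈-edges⁺ G {u} {v} e with Fin.<-cmp u v
... | tri< u<v _ _ = subst (_∈ edges G) (sym (ordered-< u<v))
  (∈-filter⁺ (λ (u , v) → u Fin.<? v ×-dec T? (adj G u v))
    (∈-cartesianProduct⁺ (∈-allFin u) (∈-allFin v)) (u<v , e))
... | tri≈ _ u≡v _ = contradiction u≡v (Adj⇒≢ G e)
... | tri> _ _ v<u = subst (_∈ edges G) (sym (ordered-> v<u))
  (∈-filter⁺ (λ (u , v) → u Fin.<? v ×-dec T? (adj G u v))
    (∈-cartesianProduct⁺ (∈-allFin v) (∈-allFin u)) (v<u , Adj-sym G e))

edges! : ∀ G → Unique (edges G)
edges! G = Unique.filter⁺ (λ (u , v) → u Fin.<? v ×-dec T? (adj G u v))
  (Unique.cartesianProduct⁺ (Unique.allFin⁺ (order G)) (Unique.allFin⁺ (order G)))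

_∈ᵉ_ : ∀ {N} → Fin N → Fin N × Fin N → Set
v ∈ᵉ (u , w) = v ≡ u ⊎ v ≡ w

_∈ᵉ?_ : ∀ {N} (v : Fin N) (e : Fin N × Fin N) → Dec (v ∈ᵉ e)
v ∈ᵉ? (u , w) = v Fin.≟ u ⊎-dec v Fin.≟ w

∈ᵉ-ordered : ∀ {N} (u v : Fin N) → u ∈ᵉ ordered u v
∈ᵉ-ordered u v with u Fin.<? v
... | yes _ = inj₁ refl
... | no  _ = inj₂ refl

degree : ∀ {N} → List (Fin N × Fin N) → Fin N → ℕ
degree es v = count (v ∈ᵉ?_) es

-- Double counting of incidences. A pair has at most two entries, and only one if they coincide,
-- hence the inequality.
handshake : ∀ {N} (es : List (Fin N × Fin N)) → ∑ (allFin N) (degree es) ≤ 2 * length es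
handshake {N} es = begin
  ∑ (allFin N) (λ v → ∑ es (λ e → 𝟙 (v ∈ᵉ? e)))
    ≡⟨ ∑-swap (allFin N) es _ ⟩
  ∑ es (λ e → ∑ (allFin N) (λ v → 𝟙 (v ∈ᵉ? e)))
    ≤⟨ ∑-mono es (λ {e} _ → ends e) ⟩
  ∑ es (λ _ → 2)
    ≡⟨ ∑-const es 2 ⟩
  length es * 2
    ≡⟨ *-comm (length es) 2 ⟩
  2 * length es ∎
  where
  open ≤-Reasoning
  ends : ∀ e → ∑ (allFin N) (λ v → 𝟙 (v ∈ᵉ? e)) ≤ 2
  ends e@(u , w) = begin
    ∑ (allFin N) (λ v → 𝟙 (v ∈ᵉ? e))
      ≤⟨ ∑-mono (allFin N) (λ {v} _ → 𝟙-⊎ (v ∈ᵉ? e) (v Fin.≟ u) (v Fin.≟ w) id) ⟩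
    ∑ (allFin N) (λ v → 𝟙 (v Fin.≟ u) + 𝟙 (v Fin.≟ w))
      ≡⟨ ∑-+ (allFin N) _ _ ⟩
    count (Fin._≟ u) (allFin N) + count (Fin._≟ w) (allFin N)
      ≤⟨ +-mono-≤ (at-most-once u) (at-most-once w) ⟩
    2 ∎
    where
    at-most-once : ∀ u → count (Fin._≟ u) (allFin N) ≤ 1
    at-most-once u = count≤1 (Fin._≟ u) (Unique.allFin⁺ N) (λ p q → trans p (sym q))

-- Markov's inequality for the degree sum. Taking d = 1 bounds the number of non-isolated vertices,
-- and d = 1 + q m the number of big ones.
count-degree≥ : ∀ G d →
  count (λ v → d ≤? degree (edges G) v) (allFin (order G)) * d ≤ 2 * size G
count-degree≥ G d = begin
  count big? vs * d                    ≡⟨ ∑-*ʳ vs (λ v → 𝟙 (big? v)) d ⟨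
  ∑ vs (λ v → 𝟙 (big? v) * d)          ≤⟨ ∑-mono vs (λ {v} _ → big*d≤ (big? v)) ⟩
  ∑ vs (degree (edges G))              ≤⟨ handshake (edges G) ⟩
  2 * size G                           ∎
  where
  open ≤-Reasoning
  vs = allFin (order G)
  big? = λ v → d ≤? degree (edges G) v
  big*d≤ : ∀ {k} (b : Dec (d ≤ k)) → 𝟙 b * d ≤ k
  big*d≤ (yes d≤k) = ≤-trans (≤-reflexive (*-identityˡ d)) d≤k
  big*d≤ (no _)    = z≤n

degree-Adj : ∀ G {u v} → Adj G u v → 1 ≤ degree (edges G) u
degree-Adj G {u} {v} e = ≤-trans (≤-reflexive (sym (𝟙-yes (u ∈ᵉ? ordered u v) (∈ᵉ-ordered u v))))
                                 (term≤∑ (λ e → 𝟙 (u ∈ᵉ? e)) (∈-edges⁺ G e))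

-- As `φ` may reverse the order of two endpoints, images of edges are sorted again. Two listed edges
-- with the same image cannot be reverses of each other, since both have their smaller endpoint
-- first.
size-mono : ∀ (G G′ : Graph) (φ : Vertex G′ → Vertex G) → Injective _≡_ _≡_ φ →
            (∀ {i j} → Adj G′ i j → Adj G (φ i) (φ j)) → size G′ ≤ size G
size-mono G G′ φ φ-inj φ-adj = injection⇒≤length (λ k → image (lookup (edges G′) k)) inj
  (λ k → ∈-edges⁺ G (φ-adj (proj₂ (∈-edges⁻ G′ (∈-lookup {xs = edges G′} k)))))
  where
  image : Vertex G′ × Vertex G′ → Vertex G × Vertex G
  image (i , j) = ordered (φ i) (φ j)
  image-inj : ∀ {e e′} → e ∈ edges G′ → e′ ∈ edges G′ → image e ≡ image e′ → e ≡ e′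
  image-inj {i , j} {i′ , j′} e∈ e′∈ eq with ordered-injective eq
  ... | inj₁ (p , q) = cong₂ _,_ (φ-inj p) (φ-inj q)
  ... | inj₂ (p , q) with refl ← φ-inj p | refl ← φ-inj q =
    contradiction (proj₁ (∈-edges⁻ G′ e∈)) (<-asym (proj₁ (∈-edges⁻ G′ e′∈)))
  inj : Injective _≡_ _≡_ (λ k → image (lookup (edges G′) k))
  inj {k} {l} eq = lookup-injective (edges! G′)
    (image-inj (∈-lookup {xs = edges G′} k) (∈-lookup {xs = edges G′} l) eq)

-- A colour formally depends on an adjacency proof, but any two such proofs are equal.
colour-cong : ∀ {r G} (c : EdgeColouring r G) {u v u′ v′} {e : Adj G u v} {e′ : Adj G u′ v′} →
              u ≡ u′ → v ≡ v′ → colour c u v e ≡ colour c u′ v′ e′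
colour-cong c {u} {v} refl refl = cong (colour c u v) (T-irrelevant _ _)

-- Discarding isolated vertices.

NoIsolated : Graph → Set
NoIsolated H = ∀ x → ∃ λ y → Adj H x y

-- A copy of a graph without isolated vertices avoids the isolated vertices
-- of G, which therefore may be discarded.
Arrows-restrict : ∀ {r H} (G G′ : Graph) (φ : Vertex G′ → Vertex G) →
                  Injective _≡_ _≡_ φ →
                  (∀ i j → adj G′ i j ≡ adj G (φ i) (φ j)) →
                  (∀ {u v} → Adj G u v → ∃ λ i → φ i ≡ u) →
                  NoIsolated H → Arrows r G H → Arrows r G′ H
Arrows-restrict {r} {H} G G′ φ φ-inj φ-adj cover noIso G→H c′ = record
  { copyColour = copyColour
  ; embed      = embed′
  ; embed-inj  = λ {x} {y} eq → embed-inj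
      (trans (sym (φ∘embed′ x)) (trans (cong φ eq) (φ∘embed′ y)))
  ; embed-edge = λ x y xy → let e , eq = embed-edge x y xy in
      subst T (sym (trans (φ-adj _ _) (cong₂ (adj G) (φ∘embed′ x) (φ∘embed′ y)))) e ,
      trans (colour-cong c′ (φ-inj (trans (φ∘embed′ x) (sym (proj₂ (cover e)))))
                            (φ-inj (trans (φ∘embed′ y) (sym (proj₂ (cover (Adj-sym G e)))))))
            eq
  }
  where
  pre-adj : ∀ {u v} (e : Adj G u v) →
            Adj G′ (proj₁ (cover e)) (proj₁ (cover (Adj-sym G e)))
  pre-adj {u} {v} e = subst T
    (sym (trans (φ-adj _ _) (cong₂ (adj G) (proj₂ (cover e)) (proj₂ (cover (Adj-sym G e)))))) e
  -- An edge of `G` takes the colour of its preimage under `φ`. The preimage of a vertex found by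
  -- `cover` depends on the chosen edge; injectivity of `φ` shows that all choices agree.
  c : EdgeColouring r G
  c = record
    { colour     = λ u v e → colour c′ _ _ (pre-adj e)
    ; colour-sym = λ u v e e′ → trans
        (colour-sym c′ _ _ (pre-adj e) (Adj-sym G′ (pre-adj e)))
        (colour-cong c′ (φ-inj (trans (proj₂ (cover (Adj-sym G e))) (sym (proj₂ (cover e′)))))
                        (φ-inj (trans (proj₂ (cover e)) (sym (proj₂ (cover (Adj-sym G e′)))))))
    }
  open MonochromaticCopy (G→H c)
  embed-cover : ∀ x → ∃ λ i → φ i ≡ embed x
  embed-cover x = cover (proj₁ (embed-edge x _ (proj₂ (noIso x))))
  embed′ : Vertex H → Vertex G′
  embed′ x = proj₁ (embed-cover x)
  φ∘embed′ : ∀ x → φ (embed′ x) ≡ embed x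
  φ∘embed′ x = proj₂ (embed-cover x)

-- Existence of the minimum

-- Exhaustive search, which extends to vectors of fixed length. Graphs, colourings and embeddings
-- are searched as vectors because these are determined by their entries without function
-- extensionality.
Searchable : Set → Set₁
Searchable A = {P : A → Set} → Decidable P → Dec (∃ P)

search-Bool : Searchable Bool
search-Bool P? = map′ (λ { (inj₁ p) → false , p ; (inj₂ p) → true , p })
                      (λ { (false , p) → inj₁ p ; (true , p) → inj₂ p })
                      (P? false ⊎-dec P? true)

search-Vec : ∀ {A} → Searchable A → ∀ n → Searchable (Vec A n)
search-Vec search zero    P? = map′ ([] ,_) (λ { ([] , p) → p }) (P? [])
search-Vec search (suc n) P? =
  map′ (λ (x , xs , p) → x ∷ xs , p) (λ { (x ∷ xs , p) → x , xs , p })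
       (search (λ x → search-Vec search n (λ xs → P? (x ∷ xs))))

Matrix : Set → ℕ → Set
Matrix A N = Vec (Vec A N) N

search-Matrix : ∀ {A} → Searchable A → ∀ N → Searchable (Matrix A N)
search-Matrix search N = search-Vec (search-Vec search N) N

_[_] : ∀ {A N} → Matrix A N → Fin N × Fin N → A
M [ u , v ] = Vec.lookup (Vec.lookup M u) v

matrix : ∀ {A N} → (Fin N → Fin N → A) → Matrix A N
matrix f = tabulate (λ u → tabulate (f u))

matrix-[] : ∀ {A N} (f : Fin N → Fin N → A) u v → matrix f [ u , v ] ≡ f u v
matrix-[] f u v = trans (cong (λ row → Vec.lookup row v) (lookup∘tabulate (λ u → tabulate (f u)) u))
                        (lookup∘tabulate (f u) v)

matrix-[]-ordered : ∀ {A N} (f : Fin N → Fin N → A) → (∀ u v → f u v ≡ f v u) →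
                    ∀ u v → matrix f [ ordered u v ] ≡ f u v
matrix-[]-ordered f f-sym u v with u Fin.<? v
... | yes _ = matrix-[] f u v
... | no  _ = trans (matrix-[] f v u) (f-sym v u)

≟-sym : ∀ {N} (u v : Fin N) → does (u Fin.≟ v) ≡ does (v Fin.≟ u)
≟-sym u v with u Fin.≟ v
... | yes u≡v = sym (dec-true (v Fin.≟ u) (sym u≡v))
... | no  u≢v = sym (dec-false (v Fin.≟ u) (u≢v ∘ sym))

-- Only entries above the diagonal are read, so every matrix is a graph and the search has no
-- symmetry or irreflexivity to test.
matrixGraph : ∀ {N} → Matrix Bool N → Graph
matrixGraph {N} M = record
  { order      = N
  ; adj        = λ u v → not (does (u Fin.≟ v)) ∧ M [ ordered u v ]
  ; adj-sym    = λ u v → cong₂ (λ b e → not b ∧ M [ e ]) (≟-sym u v) (ordered-sym u v)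
  ; adj-irrefl = λ v → cong (λ b → not b ∧ M [ ordered v v ]) (dec-true (v Fin.≟ v) refl)
  }

matrixGraph-adj : ∀ {N} (f : Fin N → Fin N → Bool) → (∀ u v → f u v ≡ f v u) →
                  (∀ v → f v v ≡ false) → ∀ u v → adj (matrixGraph (matrix f)) u v ≡ f u v
matrixGraph-adj f f-sym f-irrefl u v with u Fin.≟ v
... | yes refl = sym (f-irrefl u)
... | no  _    = matrix-[]-ordered f f-sym u v

matrixColouring : ∀ {r G} → Matrix (Fin r) (order G) → EdgeColouring r G
matrixColouring M = record
  { colour     = λ u v _ → M [ ordered u v ]
  ; colour-sym = λ u v _ _ → cong (M [_]) (ordered-sym u v)
  }

matrixColouring-surjective : ∀ {r G} (c : EdgeColouring (suc r) G) →
  ∃ λ M → ∀ u v e → colour (matrixColouring {G = G} M) u v e ≡ colour c u v e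
matrixColouring-surjective {r} {G} c =
  matrix f , λ u v e → trans (matrix-[]-ordered f f-sym u v) (f-Adj e)
  where
  f : Vertex G → Vertex G → Fin (suc r)
  f u v with T? (adj G u v)
  ... | yes e = colour c u v e
  -- Non-adjacent pairs get a default colour; this is where at least one colour must exist.
  ... | no  _ = zero
  f-Adj : ∀ {u v} (e : Adj G u v) → f u v ≡ colour c u v e
  f-Adj {u} {v} e with T? (adj G u v)
  ... | yes _ = colour-cong c refl refl
  ... | no ¬e = contradiction e ¬e
  f-sym : ∀ u v → f u v ≡ f v u
  f-sym u v with T? (adj G u v) | T? (adj G v u)
  ... | yes e | yes e′ = colour-sym c u v e e′
  ... | yes e | no ¬e′ = contradiction (Adj-sym G e) ¬e′
  ... | no ¬e | yes e′ = contradiction (Adj-sym G e′) ¬e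
  ... | no _  | no _   = refl

MonochromaticCopy-resp : ∀ {r G H} {c c′ : EdgeColouring r G} →
  (∀ u v e → colour c u v e ≡ colour c′ u v e) →
  MonochromaticCopy c H → MonochromaticCopy c′ H
MonochromaticCopy-resp c≗c′ copy = record
  { copyColour = copyColour
  ; embed      = embed
  ; embed-inj  = embed-inj
  ; embed-edge = λ x y xy → let e , eq = embed-edge x y xy in
                            e , trans (sym (c≗c′ _ _ e)) eq
  }
  where open MonochromaticCopy copy

monochromaticCopy? : ∀ {r G} (c : EdgeColouring r G) H → Dec (MonochromaticCopy c H)
monochromaticCopy? {r} {G} c H = map′
  (λ (i , f , f-inj , f-edge) → record
    { copyColour = i ; embed = Vec.lookup f
    ; embed-inj = λ {x} {y} → f-inj x y ; embed-edge = f-edge })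
  (λ copy → let open MonochromaticCopy copy
                at = lookup∘tabulate embed
            in copyColour , tabulate embed ,
               (λ x y eq → embed-inj (trans (sym (at x)) (trans eq (at y)))) ,
               (λ x y xy → let e , eq = embed-edge x y xy in
                 subst T (sym (cong₂ (adj G) (at x) (at y))) e ,
                 trans (colour-cong c (at x) (at y)) eq))
  (Fin.any? λ i → search-Vec Fin.any? (order H) λ f →
    (Fin.all? λ x → Fin.all? λ y → (Vec.lookup f x Fin.≟ Vec.lookup f y) →-dec (x Fin.≟ y))
    ×-dec
    (Fin.all? λ x → Fin.all? λ y → T? (adj H x y) →-dec coloured? i (Vec.lookup f x) (Vec.lookup f y)))
  where
  coloured? : ∀ i u v → Dec (Σ (Adj G u v) λ e → colour c u v e ≡ i)
  coloured? i u v with T? (adj G u v)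
  ... | no ¬e = no (¬e ∘ proj₁)
  ... | yes e = map′ (e ,_) (λ (_ , eq) → trans (colour-cong c refl refl) eq) (colour c u v e Fin.≟ i)

arrows? : ∀ r G H → Dec (Arrows (suc r) G H)
arrows? r G H
  with search-Matrix Fin.any? (order G) (λ M → ¬? (monochromaticCopy? (matrixColouring {G = G} M) H))
... | yes (M , ¬copy) = no λ G→H → ¬copy (G→H (matrixColouring M))
... | no  none        = yes λ c → let M , M≗c = matrixColouring-surjective c in
  MonochromaticCopy-resp M≗c
    -- The failed search yields only a double negation, which can be removed because having a copy
    -- is decidable.
    (decidable-stable (monochromaticCopy? (matrixColouring M) H) (λ ¬copy → none (M , ¬copy)))

ArrowedWithin : ℕ → Graph → ℕ → Set
ArrowedWithin r H s = ∃ λ G → Arrows r G H × size G ≤ s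

-- A graph of size s has at most 2s non-isolated vertices.
matrixWitness : ∀ {r H s} → NoIsolated H → ArrowedWithin r H s →
  ∃ λ (k : Fin (suc (2 * s))) → ∃ λ (M : Matrix Bool (toℕ k)) →
    Arrows r (matrixGraph M) H × size (matrixGraph M) ≤ s
matrixWitness {r} {H} {s} noIso (G , G→H , size≤s) =
  fromℕ< k<1+2s ,
  subst (λ k → ∃ λ (M : Matrix Bool k) → Arrows r (matrixGraph M) H × size (matrixGraph M) ≤ s)
    (sym (Fin.toℕ-fromℕ< k<1+2s))
    (matrix f ,
     Arrows-restrict G (matrixGraph (matrix f)) φ φ-inj adj≡ cover noIso G→H ,
     ≤-trans (size-mono G (matrixGraph (matrix f)) φ φ-inj (λ {i} {j} → subst T (adj≡ i j))) size≤s)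
  where
  nonIsolated? : Decidable (λ v → 1 ≤ degree (edges G) v)
  nonIsolated? v = 1 ≤? degree (edges G) v
  vs = filter nonIsolated? (allFin (order G))
  φ = lookup vs
  φ-inj : Injective _≡_ _≡_ φ
  φ-inj = lookup-injective (Unique.filter⁺ nonIsolated? (Unique.allFin⁺ (order G)))
  k<1+2s : length vs < suc (2 * s)
  k<1+2s = s≤s (begin
    length vs                                   ≡⟨ length-filter nonIsolated? (allFin (order G)) ⟩
    count nonIsolated? (allFin (order G))       ≡⟨ *-identityʳ _ ⟨
    count nonIsolated? (allFin (order G)) * 1   ≤⟨ count-degree≥ G 1 ⟩
    2 * size G                                  ≤⟨ *-monoʳ-≤ 2 size≤s ⟩
    2 * s                                       ∎)
    where open ≤-Reasoning
  f : Fin (length vs) → Fin (length vs) → Bool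
  f i j = adj G (φ i) (φ j)
  adj≡ : ∀ i j → adj (matrixGraph (matrix f)) i j ≡ f i j
  adj≡ = matrixGraph-adj f (λ i j → adj-sym G (φ i) (φ j)) (λ i → adj-irrefl G (φ i))
  cover : ∀ {u v} → Adj G u v → ∃ λ i → φ i ≡ u
  cover {u} e = index u∈vs , sym (lookup-index u∈vs)
    where
    u∈vs : u ∈ vs
    u∈vs = ∈-filter⁺ nonIsolated? (∈-allFin u) (degree-Adj G e)

-- By `matrixWitness` the order may be assumed to be at most 2 s, which leaves finitely many
-- matrices to try.
arrowedWithin? : ∀ r {H} → NoIsolated H → Decidable (ArrowedWithin (suc r) H)
arrowedWithin? r {H} noIso s = map′
  (λ (_ , M , G→H , size≤s) → matrixGraph M , G→H , size≤s)
  (matrixWitness noIso)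
  (Fin.any? λ k → search-Matrix search-Bool (toℕ k) λ M →
    arrows? r (matrixGraph M) H ×-dec size (matrixGraph M) ≤? s)

least : ∀ {P : ℕ → Set} → Decidable P → ∀ s → P s →
        ∃ λ k → k ≤ s × P k × (∀ {j} → P j → k ≤ j)
least P? s Ps with P? 0
least P? s       Ps | yes P0 = 0 , z≤n , P0 , λ _ → z≤n
least P? zero    Ps | no ¬P0 = contradiction Ps ¬P0
least P? (suc s) Ps | no ¬P0 with k , k≤s , Pk , k-min ← least (P? ∘ suc) s Ps =
  suc k , s≤s k≤s , Pk , λ { {zero} P0 → contradiction P0 ¬P0 ; {suc j} Pj → s≤s (k-min Pj) }

sizeRamseyNumber : ∀ r {H} → NoIsolated H → ∀ {s} → ArrowedWithin (suc r) H s →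
                   ∃ λ k → IsSizeRamseyNumber (suc r) H k × k ≤ s
sizeRamseyNumber r noIso {s} within
  with k , k≤s , (G , G→H , size≤k) , k-min ← least (arrowedWithin? r noIso) s within =
  -- The witness has at most k edges, and at least k by minimality applied to its own size.
  k , ((G , G→H , ≤-antisym size≤k (k-min (G , G→H , ≤-refl))) ,
       λ G′ G′→H → k-min (G′ , G′→H , ≤-refl)) , k≤s

-- Upper bound

↑ˡ≢↑ʳ : ∀ {a b} {i : Fin a} {j : Fin b} → i ↑ˡ b ≢ a ↑ʳ j
↑ˡ≢↑ʳ {a} {b} {i} {j} eq with trans (sym (Fin.splitAt-↑ˡ a i b))
                                   (trans (cong (splitAt a) eq) (Fin.splitAt-↑ʳ a b j))
... | ()

node : ∀ {n m} → Fin (1 + n) ⊎ Fin (1 + m) → Vertex (doubleStar n m)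
node {n} {m} = join (1 + n) (1 + m)

node-injective : ∀ {n m} → Injective _≡_ _≡_ (node {n} {m})
node-injective {n} {m} {x} {y} eq =
  trans (sym (Fin.splitAt-join (1 + n) (1 + m) x))
        (trans (cong (splitAt (1 + n)) eq) (Fin.splitAt-join (1 + n) (1 + m) y))

node-Adj : ∀ {n m} x y → T (doubleStarAdj {n} {m} x y) → Adj (doubleStar n m) (node x) (node y)
node-Adj {n} {m} x y = subst T (sym (cong₂ doubleStarAdj
  (Fin.splitAt-join (1 + n) (1 + m) x) (Fin.splitAt-join (1 + n) (1 + m) y)))

doubleStar-noIsolated : ∀ n m → NoIsolated (doubleStar n m)
doubleStar-noIsolated n m v =
  let y , xy = neighbour (splitAt (1 + n) v) in
  node y , subst (λ v → Adj (doubleStar n m) v (node y))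
                 (Fin.join-splitAt (1 + n) (1 + m) v) (node-Adj (splitAt (1 + n) v) y xy)
  where
  neighbour : ∀ x → ∃ λ y → T (doubleStarAdj {n} {m} x y)
  neighbour (inj₁ zero)    = inj₂ zero , tt
  neighbour (inj₁ (suc _)) = inj₁ zero , tt
  neighbour (inj₂ zero)    = inj₁ zero , tt
  neighbour (inj₂ (suc _)) = inj₂ zero , tt

-- Complete bipartite graphs and their monochromatic double stars.

bipartiteAdj : ∀ {a b} → Fin a ⊎ Fin b → Fin a ⊎ Fin b → Bool
bipartiteAdj (inj₁ _) (inj₁ _) = false
bipartiteAdj (inj₁ _) (inj₂ _) = true
bipartiteAdj (inj₂ _) (inj₁ _) = true
bipartiteAdj (inj₂ _) (inj₂ _) = false

bipartiteAdj-sym : ∀ {a b} (x y : Fin a ⊎ Fin b) → bipartiteAdj x y ≡ bipartiteAdj y x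
bipartiteAdj-sym (inj₁ _) (inj₁ _) = refl
bipartiteAdj-sym (inj₁ _) (inj₂ _) = refl
bipartiteAdj-sym (inj₂ _) (inj₁ _) = refl
bipartiteAdj-sym (inj₂ _) (inj₂ _) = refl

bipartiteAdj-irrefl : ∀ {a b} (x : Fin a ⊎ Fin b) → bipartiteAdj x x ≡ false
bipartiteAdj-irrefl (inj₁ _) = refl
bipartiteAdj-irrefl (inj₂ _) = refl

completeBipartite : ℕ → ℕ → Graph
completeBipartite a b = record
  { order      = a + b
  ; adj        = λ u v → bipartiteAdj (splitAt a u) (splitAt a v)
  ; adj-sym    = λ u v → bipartiteAdj-sym (splitAt a u) (splitAt a v)
  ; adj-irrefl = λ v → bipartiteAdj-irrefl (splitAt a v)
  }

completeBipartite-Adj : ∀ {a b} (i : Fin a) (j : Fin b) →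
                        Adj (completeBipartite a b) (i ↑ˡ b) (a ↑ʳ j)
completeBipartite-Adj {a} {b} i j =
  subst T (sym (cong₂ bipartiteAdj (Fin.splitAt-↑ˡ a i b) (Fin.splitAt-↑ʳ a b j))) tt

completeBipartite-size : ∀ a b → size (completeBipartite a b) ≤ a * b
completeBipartite-size a b = begin
  size K
    ≤⟨ injection⇒≤length (lookup (edges K)) (lookup-injective (edges! K))
         (λ k → crossing (∈-lookup {xs = edges K} k)) ⟩
  length (map pair (allFin (a * b)))
    ≡⟨ trans (length-map pair (allFin (a * b))) (length-allFin (a * b)) ⟩
  a * b ∎
  where
  open ≤-Reasoning
  K = completeBipartite a b
  ends : Fin a × Fin b → Vertex K × Vertex K
  ends (i , j) = i ↑ˡ b , a ↑ʳ j
  pair : Fin (a * b) → Vertex K × Vertex K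
  pair k = ends (remQuot b k)
  pair-combine : ∀ i j → pair (combine i j) ≡ (i ↑ˡ b , a ↑ʳ j)
  pair-combine i j = cong ends (Fin.remQuot-combine i j)
  crossing : ∀ {e} → e ∈ edges K → e ∈ map pair (allFin (a * b))
  crossing {u , v} e∈ with splitAt a u in eqᵤ | splitAt a v in eqᵥ | ∈-edges⁻ K e∈
  ... | inj₁ i | inj₂ j | _
    with refl ← Fin.splitAt⁻¹-↑ˡ {a} {b} {u} eqᵤ | refl ← Fin.splitAt⁻¹-↑ʳ {a} {b} {v} eqᵥ =
    subst (_∈ map pair (allFin (a * b))) (pair-combine i j) (∈-map⁺ pair (∈-allFin (combine i j)))
  -- Left vertices precede right ones, so this orientation is never listed.
  ... | inj₂ j | inj₁ i | u<v , _
    with refl ← Fin.splitAt⁻¹-↑ʳ {a} {b} {u} eqᵤ | refl ← Fin.splitAt⁻¹-↑ˡ {a} {b} {v} eqᵥ =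
    contradiction u<v (≤⇒≯ (begin
      toℕ (i ↑ˡ b)  ≡⟨ Fin.toℕ-↑ˡ i b ⟩
      toℕ i         ≤⟨ <⇒≤ (Fin.toℕ<n i) ⟩
      a             ≤⟨ m≤m+n a (toℕ j) ⟩
      a + toℕ j     ≡⟨ Fin.toℕ-↑ʳ a j ⟨
      toℕ (a ↑ʳ j)  ∎))

-- Ensures that one centre comes first among the chosen neighbours of the other. If `x` is already a
-- value of `f`, it is moved to the front; otherwise it replaces the value at `zero`.
rebase : ∀ {k a} {P : Fin a → Set} (f : Fin (1 + k) → Fin a) → Injective _≡_ _≡_ f →
         (∀ j → P (f j)) → ∀ x → P x →
         Σ (Fin (1 + k) → Fin a) λ g → Injective _≡_ _≡_ g × (∀ j → P (g j)) × g zero ≡ x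
rebase {k} {a} {P} f f-inj Pf x Px with Fin.any? (λ j → f j Fin.≟ x)
... | yes (i , refl) = g , g-inj , Pg , refl
  where
  g : Fin (1 + k) → Fin a
  g zero    = f i
  g (suc j) = f (punchIn i j)
  g-inj : Injective _≡_ _≡_ g
  g-inj {zero}  {zero}  eq = refl
  g-inj {zero}  {suc j} eq = contradiction (sym (f-inj eq)) (Fin.punchInᵢ≢i i j)
  g-inj {suc j} {zero}  eq = contradiction (f-inj eq) (Fin.punchInᵢ≢i i j)
  g-inj {suc j} {suc l} eq = cong suc (Fin.punchIn-injective i j l (f-inj eq))
  Pg : ∀ j → P (g j)
  Pg zero    = Px
  Pg (suc j) = Pf (punchIn i j)
... | no x∉f = g , g-inj , Pg , refl
  where
  g : Fin (1 + k) → Fin a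
  g zero    = x
  g (suc j) = f (suc j)
  g-inj : Injective _≡_ _≡_ g
  g-inj {zero}  {zero}  eq = refl
  g-inj {zero}  {suc j} eq = contradiction (suc j , sym eq) x∉f
  g-inj {suc j} {zero}  eq = contradiction (suc j , eq) x∉f
  g-inj {suc j} {suc l} eq = f-inj eq
  Pg : ∀ j → P (g j)
  Pg zero    = Px
  Pg (suc j) = Pf (suc j)

module _ {r a b : ℕ} (c : EdgeColouring r (completeBipartite a b)) where

  edgeColour : Fin a → Fin b → Fin r
  edgeColour i j = colour c (i ↑ˡ b) (a ↑ʳ j) (completeBipartite-Adj i j)

  leftDegree : Fin a → Fin r → ℕ
  leftDegree i k = count (λ j → edgeColour i j Fin.≟ k) (allFin b)

  rightDegree : Fin b → Fin r → ℕ
  rightDegree j k = count (λ i → edgeColour i j Fin.≟ k) (allFin a)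

  -- The centre with n leaves is placed at the right end `j` and the one with m leaves at the left
  -- end `i`. Each has one neighbour more than leaves, namely the other centre. The two sets of
  -- leaves lie on opposite sides, so they are disjoint.
  doubleStarAt : ∀ {n m} i j → m < leftDegree i (edgeColour i j) → n < rightDegree j (edgeColour i j) →
                 MonochromaticCopy c (doubleStar n m)
  doubleStarAt {n} {m} i j m< n<
    with f₀ , f₀-inj , Pf₀ ← count⇒injection (λ i′ → edgeColour i′ j Fin.≟ edgeColour i j) (Unique.allFin⁺ a) n<
    with f , f-inj , Pf , refl ← rebase {P = λ i′ → edgeColour i′ j ≡ edgeColour i j} f₀ f₀-inj Pf₀ i refl
    with g₀ , g₀-inj , Pg₀ ← count⇒injection (λ j′ → edgeColour i j′ Fin.≟ edgeColour i j) (Unique.allFin⁺ b) m<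
    with g , g-inj , Pg , refl ← rebase {P = λ j′ → edgeColour i j′ ≡ edgeColour i j} g₀ g₀-inj Pg₀ j refl
    = record
    { copyColour = k
    ; embed      = λ v → place (splitAt (1 + n) v)
    ; embed-inj  = λ {u} {v} eq →
        trans (sym (Fin.join-splitAt (1 + n) (1 + m) u))
          (trans (cong node (place-inj (splitAt (1 + n) u) (splitAt (1 + n) v) eq))
                 (Fin.join-splitAt (1 + n) (1 + m) v))
    ; embed-edge = λ u v → place-edge (splitAt (1 + n) u) (splitAt (1 + n) v)
    }
    where
    K = completeBipartite a b
    k = edgeColour (f zero) (g zero)
    place : Fin (1 + n) ⊎ Fin (1 + m) → Vertex K
    place (inj₁ zero)    = a ↑ʳ g zero
    place (inj₁ (suc l)) = f (suc l) ↑ˡ b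
    place (inj₂ zero)    = f zero ↑ˡ b
    place (inj₂ (suc l)) = a ↑ʳ g (suc l)
    Coloured : Vertex K → Vertex K → Set
    Coloured u v = Σ (Adj K u v) λ e → colour c u v e ≡ k
    flip : ∀ {u v} → Coloured u v → Coloured v u
    flip {u} {v} (e , eq) = Adj-sym K e , trans (sym (colour-sym c u v e (Adj-sym K e))) eq
    cross : ∀ i j → edgeColour i j ≡ k → Coloured (i ↑ˡ b) (a ↑ʳ j)
    cross i j eq = completeBipartite-Adj i j , eq
    place-edge : ∀ x y → T (doubleStarAdj x y) → Coloured (place x) (place y)
    place-edge (inj₁ zero)    (inj₁ (suc l)) _ = flip (cross (f (suc l)) (g zero) (Pf (suc l)))
    place-edge (inj₁ (suc l)) (inj₁ zero)    _ = cross (f (suc l)) (g zero) (Pf (suc l))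
    place-edge (inj₁ zero)    (inj₂ zero)    _ = flip (cross (f zero) (g zero) refl)
    place-edge (inj₂ zero)    (inj₁ zero)    _ = cross (f zero) (g zero) refl
    place-edge (inj₂ zero)    (inj₂ (suc l)) _ = cross (f zero) (g (suc l)) (Pg (suc l))
    place-edge (inj₂ (suc l)) (inj₂ zero)    _ = flip (cross (f zero) (g (suc l)) (Pg (suc l)))
    place-edge (inj₂ (suc _)) (inj₁ zero)    ()
    place-edge (inj₂ (suc _)) (inj₁ (suc _)) ()
    left-inj : ∀ {l l′} → f l ↑ˡ b ≡ f l′ ↑ˡ b → l ≡ l′
    left-inj eq = f-inj (Fin.↑ˡ-injective b _ _ eq)
    right-inj : ∀ {l l′} → a ↑ʳ g l ≡ a ↑ʳ g l′ → l ≡ l′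
    right-inj eq = g-inj (Fin.↑ʳ-injective a _ _ eq)
    place-inj : ∀ x y → place x ≡ place y → x ≡ y
    place-inj (inj₁ zero)    (inj₁ zero)    eq = refl
    place-inj (inj₁ zero)    (inj₁ (suc _)) eq = contradiction (sym eq) ↑ˡ≢↑ʳ
    place-inj (inj₁ zero)    (inj₂ zero)    eq = contradiction (sym eq) ↑ˡ≢↑ʳ
    place-inj (inj₁ zero)    (inj₂ (suc _)) eq = contradiction (right-inj eq) λ ()
    place-inj (inj₁ (suc _)) (inj₁ zero)    eq = contradiction eq ↑ˡ≢↑ʳ
    place-inj (inj₁ (suc _)) (inj₁ (suc _)) eq = cong inj₁ (left-inj eq)
    place-inj (inj₁ (suc _)) (inj₂ zero)    eq = contradiction (left-inj eq) λ ()
    place-inj (inj₁ (suc _)) (inj₂ (suc _)) eq = contradiction eq ↑ˡ≢↑ʳ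
    place-inj (inj₂ zero)    (inj₁ zero)    eq = contradiction eq ↑ˡ≢↑ʳ
    place-inj (inj₂ zero)    (inj₁ (suc _)) eq = contradiction (left-inj eq) λ ()
    place-inj (inj₂ zero)    (inj₂ zero)    eq = refl
    place-inj (inj₂ zero)    (inj₂ (suc _)) eq = contradiction eq ↑ˡ≢↑ʳ
    place-inj (inj₂ (suc _)) (inj₁ zero)    eq = contradiction (right-inj eq) λ ()
    place-inj (inj₂ (suc _)) (inj₁ (suc _)) eq = contradiction (sym eq) ↑ˡ≢↑ʳ
    place-inj (inj₂ (suc _)) (inj₂ zero)    eq = contradiction (sym eq) ↑ˡ≢↑ʳ
    place-inj (inj₂ (suc _)) (inj₂ (suc _)) eq = cong inj₂ (right-inj eq)

  -- Every edge is charged to an end at which its colour is rare. By `count-rare≤` a left vertex is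
  -- charged at most r m times and a right vertex at most r n times.
  sparse⇒few-edges : ∀ n m →
    (∀ i j → leftDegree i (edgeColour i j) ≤ m ⊎ rightDegree j (edgeColour i j) ≤ n) →
    a * b ≤ a * (r * m) + b * (r * n)
  sparse⇒few-edges n m sparse = begin
    a * b
      ≡⟨ cong₂ _*_ (length-allFin a) (trans (*-identityʳ _) (length-allFin b)) ⟨
    length as * (length bs * 1)
      ≡⟨ trans (∑-cong as (λ _ → ∑-const bs 1)) (∑-const as _) ⟨
    ∑ as (λ i → ∑ bs (λ j → 1))
      ≤⟨ ∑-mono as (λ {i} _ → ∑-mono bs (λ {j} _ → 𝟙-⊎ (yes tt) (low₁? i j) (low₂? i j) (λ _ → sparse i j))) ⟩
    ∑ as (λ i → ∑ bs (λ j → 𝟙 (low₁? i j) + 𝟙 (low₂? i j)))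
      ≡⟨ trans (∑-cong as (λ _ → ∑-+ bs _ _)) (∑-+ as _ _) ⟩
    ∑ as (λ i → ∑ bs (λ j → 𝟙 (low₁? i j))) + ∑ as (λ i → ∑ bs (λ j → 𝟙 (low₂? i j)))
      ≡⟨ cong (∑ as (λ i → ∑ bs (λ j → 𝟙 (low₁? i j))) +_) (∑-swap as bs _) ⟩
    ∑ as (λ i → ∑ bs (λ j → 𝟙 (low₁? i j))) + ∑ bs (λ j → ∑ as (λ i → 𝟙 (low₂? i j)))
      ≤⟨ +-mono-≤ (∑-mono as (λ {i} _ → count-rare≤ (edgeColour i) m bs))
                  (∑-mono bs (λ {j} _ → count-rare≤ (λ i → edgeColour i j) n as)) ⟩
    ∑ as (λ _ → r * m) + ∑ bs (λ _ → r * n)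
      ≡⟨ cong₂ _+_ (∑-const as _) (∑-const bs _) ⟩
    length as * (r * m) + length bs * (r * n)
      ≡⟨ cong₂ (λ x y → x * (r * m) + y * (r * n)) (length-allFin a) (length-allFin b) ⟩
    a * (r * m) + b * (r * n) ∎
    where
    open ≤-Reasoning
    as = allFin a
    bs = allFin b
    low₁? = λ i j → leftDegree i (edgeColour i j) ≤? m
    low₂? = λ i j → rightDegree j (edgeColour i j) ≤? n

  completeBipartite-copy : ∀ n m → a * (r * m) + b * (r * n) < a * b → MonochromaticCopy c (doubleStar n m)
  completeBipartite-copy n m many
    with Fin.any? (λ i → Fin.any? (λ j → m <? leftDegree i (edgeColour i j) ×-dec
                                         n <? rightDegree j (edgeColour i j)))
  ... | yes (i , j , m< , n<) = doubleStarAt i j m< n<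
  ... | no none = contradiction (sparse⇒few-edges n m sparse) (<⇒≱ many)
    where
    sparse : ∀ i j → leftDegree i (edgeColour i j) ≤ m ⊎ rightDegree j (edgeColour i j) ≤ n
    sparse i j with m <? leftDegree i (edgeColour i j) | n <? rightDegree j (edgeColour i j)
    ... | no m≮  | _      = inj₁ (≮⇒≥ m≮)
    ... | yes _  | no n≮  = inj₂ (≮⇒≥ n≮)
    ... | yes m< | yes n< = contradiction (i , j , m< , n<) none

upperBound : ∀ r n m → ArrowedWithin r (doubleStar n m) (4 * r ^ 2 * n * m + 2 * r * (n + m) + 1)
upperBound r n m = completeBipartite a b ,
  (λ c → completeBipartite-copy c n m (m+n≤o⇒m≤o _ (≤-reflexive (excess r n m)))) ,
  ≤-trans (completeBipartite-size a b) (≤-reflexive (edge-count r n m))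
  where
  -- With these sides the charges total 4 r² n m + r (n + m), while there are 4 r² n m + 2 r (n + m)
  -- + 1 edges.
  a = 1 + 2 * r * n
  b = 1 + 2 * r * m
  excess : ∀ r n m →
    1 + ((1 + 2 * r * n) * (r * m) + (1 + 2 * r * m) * (r * n)) + (r * m + r * n) ≡
    (1 + 2 * r * n) * (1 + 2 * r * m)
  excess = solve-∀
  edge-count : ∀ r n m →
    (1 + 2 * r * n) * (1 + 2 * r * m) ≡ 4 * (r * (r * 1)) * n * m + 2 * r * (n + m) + 1
  edge-count = solve-∀

-- Lower bound

colourDegree : ∀ {N r} → (Fin N × Fin N → Fin r) → List (Fin N × Fin N) → Fin N → Fin r → ℕ
colourDegree g es v i = count (λ e → v ∈ᵉ? e ×-dec g e Fin.≟ i) es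

-- An edge has a single colour, so distinct colours count distinct edges at `v`.
∑-colourDegree≤degree : ∀ {N r} (g : Fin N × Fin N → Fin r) es v {cs : List (Fin r)} → Unique cs →
                        ∑ cs (colourDegree g es v) ≤ degree es v
∑-colourDegree≤degree g es v {cs} cs! = begin
  ∑ cs (λ i → ∑ es (λ e → 𝟙 (v ∈ᵉ? e ×-dec g e Fin.≟ i)))
    ≡⟨ ∑-swap cs es _ ⟩
  ∑ es (λ e → ∑ cs (λ i → 𝟙 (v ∈ᵉ? e ×-dec g e Fin.≟ i)))
    ≤⟨ ∑-mono es (λ {e} _ → once (v ∈ᵉ? e) e) ⟩
  ∑ es (λ e → 𝟙 (v ∈ᵉ? e)) ∎
  where
  open ≤-Reasoning
  once : ∀ {P : Set} (d : Dec P) e → ∑ cs (λ i → 𝟙 (d ×-dec g e Fin.≟ i)) ≤ 𝟙 d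
  once (yes v∈e) e = count≤1 (λ i → yes v∈e ×-dec g e Fin.≟ i) cs!
                       (λ (_ , p) (_ , q) → trans (sym p) q)
  once (no v∉e)  e = ≤-reflexive (count-none (λ i → no v∉e ×-dec g e Fin.≟ i) cs (λ _ → v∉e ∘ proj₁))

-- Pigeonhole principle: if every entry satisfied P or Q, the two counts would add up to at least
-- the length.
unmarked : ∀ {A : Set} {P Q : A → Set} (P? : Decidable P) (Q? : Decidable Q) (xs : List A) →
           count P? xs + count Q? xs < length xs → ∃ λ x → x ∈ xs × ¬ P x × ¬ Q x
unmarked P? Q? xs few with any? (λ x → ¬? (P? x) ×-dec ¬? (Q? x)) xs
... | yes found = find found
... | no  none  = contradiction few (≤⇒≯ (begin
  length xs
    ≡⟨ trans (∑-const xs 1) (*-identityʳ _) ⟨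
  ∑ xs (λ _ → 1)
    ≤⟨ ∑-mono xs (λ {x} x∈xs → 𝟙-⊎ (yes tt) (P? x) (Q? x) (λ _ → marked x∈xs)) ⟩
  ∑ xs (λ x → 𝟙 (P? x) + 𝟙 (Q? x))
    ≡⟨ ∑-+ xs _ _ ⟩
  count P? xs + count Q? xs ∎))
  where
  open ≤-Reasoning
  marked : ∀ {x} → x ∈ xs → _ ⊎ _
  marked {x} x∈xs with P? x | Q? x
  ... | yes p | _     = inj₁ p
  ... | no _  | yes q = inj₂ q
  ... | no ¬p | no ¬q = contradiction (lose x∈xs (¬p , ¬q)) none

-- Colours are assigned one edge at a time. A small vertex sees fewer than q m
-- other edges, so fewer than q colours are used up at it: q colours suffice
-- for an edge with one small end, and 2 q - 1 ≤ p + q colours for an edge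
-- with two.
module Greedy {N : ℕ} (p q m : ℕ) {Small : Fin N → Set} (Small? : Decidable Small)
              (1≤q : 1 ≤ q) (q≤1+p : q ≤ 1 + p) where

  private
    Edge = Fin N × Fin N

  Blocked : (Edge → Fin (p + q)) → List Edge → Fin N → Fin (p + q) → Set
  Blocked g es v i = Small v × m ≤ colourDegree g es v i

  blocked? : ∀ g es v → Decidable (Blocked g es v)
  blocked? g es v i = Small? v ×-dec m ≤? colourDegree g es v i

  HasRoom : List Edge → Fin N → Set
  HasRoom es v = Small v → degree es v < q * m

  -- Every blocked colour uses m of the fewer than q m edges at a small vertex. At any other vertex
  -- nothing is blocked, and 0 < q.
  blocked<q : ∀ g es v → HasRoom es v → ∀ {cs} → Unique cs → count (blocked? g es v) cs < q
  blocked<q g es v room {cs} cs! with Small? v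
  ... | no ¬small = ≤-trans (≤-reflexive (cong suc (count-none (λ i → no ¬small ×-dec m ≤? colourDegree g es v i) cs (λ _ → ¬small ∘ proj₁)))) 1≤q
  ... | yes small = *-cancelʳ-< m _ _ (begin-strict
    count full? cs * m             ≡⟨ ∑-*ʳ cs (λ i → 𝟙 (full? i)) m ⟨
    ∑ cs (λ i → 𝟙 (full? i) * m)   ≤⟨ ∑-mono cs (λ {i} _ → full*m≤ (full? i)) ⟩
    ∑ cs (colourDegree g es v)     ≤⟨ ∑-colourDegree≤degree g es v cs! ⟩
    degree es v                    <⟨ room small ⟩
    q * m                          ∎)
    where
    open ≤-Reasoning
    full? = λ i → yes small ×-dec m ≤? colourDegree g es v i
    full*m≤ : ∀ {k} (d : Dec (Small v × m ≤ k)) → 𝟙 d * m ≤ k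
    full*m≤ (yes (_ , m≤k)) = ≤-trans (≤-reflexive (*-identityˡ m)) m≤k
    full*m≤ (no _)          = z≤n

  blocked≡0 : ∀ g es v → ¬ Small v → ∀ cs → count (blocked? g es v) cs ≡ 0
  blocked≡0 g es v ¬small cs = count-none (blocked? g es v) cs (λ _ → ¬small ∘ proj₁)

  -- The last q colours are those of the form `p ↑ʳ j`. An edge with two big ends also receives one
  -- of them, until `mix` recolours it.
  Admissible : Edge → Fin (p + q) → Set
  Admissible (u , w) i = (Small u × Small w) ⊎ ∃ λ j → i ≡ p ↑ʳ j

  extend : ∀ g es u w → HasRoom es u → HasRoom es w →
           ∃ λ i → ¬ Blocked g es u i × ¬ Blocked g es w i × Admissible (u , w) i
  extend g es u w room-u room-w = by-size (Small? u) (Small? w)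
    where
    upper : List (Fin (p + q))
    upper = map (p ↑ʳ_) (allFin q)
    upper! : Unique upper
    upper! = Unique.map⁺ (Fin.↑ʳ-injective p _ _) (Unique.allFin⁺ q)
    length-upper : length upper ≡ q
    length-upper = trans (length-map (p ↑ʳ_) (allFin q)) (length-allFin q)
    B? = blocked? g es
    choose-upper : count (B? u) upper + count (B? w) upper < q → _
    choose-upper few
      with i , i∈ , ¬bu , ¬bw ← unmarked (B? u) (B? w) upper (≤-trans few (≤-reflexive (sym length-upper)))
      with j , _ , eq ← ∈-map⁻ (p ↑ʳ_) i∈ = i , ¬bu , ¬bw , inj₂ (j , eq)
    few-blocked : count (B? u) (allFin (p + q)) + count (B? w) (allFin (p + q)) < length (allFin (p + q))
    few-blocked = begin-strict
      count (B? u) (allFin (p + q)) + count (B? w) (allFin (p + q))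
        <⟨ +-mono-<-≤ (blocked<q g es u room-u (Unique.allFin⁺ (p + q)))
             (s≤s⁻¹ (≤-trans (blocked<q g es w room-w (Unique.allFin⁺ (p + q))) q≤1+p)) ⟩
      q + p                   ≡⟨ +-comm q p ⟩
      p + q                   ≡⟨ length-allFin (p + q) ⟨
      length (allFin (p + q)) ∎
      where open ≤-Reasoning
    by-size : Dec (Small u) → Dec (Small w) → _
    by-size (yes su) (yes sw)
      with i , _ , ¬bu , ¬bw ← unmarked (B? u) (B? w) (allFin (p + q)) few-blocked
      = i , ¬bu , ¬bw , inj₁ (su , sw)
    -- The big end blocks nothing, and the other end blocks fewer than q colours, so one of the last
    -- q is free.
    by-size (no ¬su) _ = choose-upper
      (subst (λ k → k + count (B? w) upper < q) (sym (blocked≡0 g es u ¬su upper))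
             (blocked<q g es w room-w upper!))
    by-size (yes _) (no ¬sw) = choose-upper
      (subst (λ k → count (B? u) upper + k < q) (sym (blocked≡0 g es w ¬sw upper))
             (subst (_< q) (sym (+-identityʳ _)) (blocked<q g es u room-u upper!)))

  Good : (Edge → Fin (p + q)) → List Edge → Set
  Good g es = (∀ {v} → Small v → ∀ i → colourDegree g es v i ≤ m) ×
              (∀ {e} → e ∈ es → Admissible e (g e))

  -- The edge `e` itself takes up one of the at most q m places at its end.
  hasRoom : ∀ e es → (∀ {v} → Small v → degree (e ∷ es) v ≤ q * m) →
            ∀ {v} → v ∈ᵉ e → HasRoom es v
  hasRoom e es room {v} v∈e small =
    ≤-trans (≤-reflexive (cong (_+ degree es v) (sym (𝟙-yes (v ∈ᵉ? e) v∈e)))) (room small)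

  greedy : ∀ {es} → Unique es → (∀ {v} → Small v → degree es v ≤ q * m) → ∃ λ g → Good g es
  -- Any colour serves as the initial value; 1 ≤ q provides one.
  greedy {[]} [] _ = (λ _ → fromℕ< (≤-trans 1≤q (m≤n+m q p))) , (λ _ _ → z≤n) , λ ()
  greedy {e@(u , w) ∷ es} (e∉es ∷ es!) room
    with g , few , adm ← greedy es! (λ {v} small → ≤-trans (m≤n+m _ _) (room small))
    with i , ¬bu , ¬bw , adm-e ← extend g es u w (hasRoom e es room (inj₁ refl)) (hasRoom e es room (inj₂ refl))
    = g′ , few′ , adm′
    where
    _≟ᵉ_ = ≡-dec Fin._≟_ Fin._≟_
    -- Since `e` does not occur in `es`, redefining its colour disturbs no earlier edge.
    g′ : Edge → Fin (p + q)
    g′ f = if does (f ≟ᵉ e) then i else g f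
    g′-e : g′ e ≡ i
    g′-e with e ≟ᵉ e
    ... | yes _  = refl
    ... | no e≢e = contradiction refl e≢e
    g′-es : ∀ {f} → f ∈ es → g′ f ≡ g f
    g′-es {f} f∈es with f ≟ᵉ e
    ... | yes refl = contradiction refl (All.lookup e∉es f∈es)
    ... | no _     = refl
    unchanged : ∀ v k → colourDegree g′ es v k ≡ colourDegree g es v k
    unchanged v k = ∑-cong es (λ {f} f∈es →
      cong (λ c → 𝟙 (v ∈ᵉ? f ×-dec c Fin.≟ k)) (g′-es f∈es))
    ¬full : ∀ {v} → Small v → v ∈ᵉ e → colourDegree g es v i < m
    ¬full small (inj₁ refl) = ≰⇒> (λ full → ¬bu (small , full))
    ¬full small (inj₂ refl) = ≰⇒> (λ full → ¬bw (small , full))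
    few′ : ∀ {v} → Small v → ∀ k → colourDegree g′ (e ∷ es) v k ≤ m
    few′ {v} small k = step (v ∈ᵉ? e) (g′ e Fin.≟ k)
      (λ v∈e g′e≡k → subst (_< m) (sym (unchanged v k))
        (subst (λ c → colourDegree g es v c < m) (trans (sym g′-e) g′e≡k) (¬full small v∈e)))
      (subst (_≤ m) (sym (unchanged v k)) (few small k))
      where
      step : ∀ {P Q : Set} {n} (d : Dec P) (f : Dec Q) → (P → Q → n < m) → n ≤ m →
             𝟙 (d ×-dec f) + n ≤ m
      step (yes p) (yes q) n<m _   = n<m p q
      step (yes _) (no _)  _   n≤m = n≤m
      step (no _)  (yes _) _   n≤m = n≤m
      step (no _)  (no _)  _   n≤m = n≤m
    adm′ : ∀ {f} → f ∈ e ∷ es → Admissible f (g′ f)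
    adm′ (here refl)  = subst (Admissible e) (sym g′-e) adm-e
    adm′ (there f∈es) = subst (Admissible _) (sym (g′-es f∈es)) (adm f∈es)

-- No double star on M vertices is monochromatic: together with symmetry of χ,
-- the condition also covers the centres x and y themselves.
Starless : ∀ {K p} → (Fin K → Fin K → Fin p) → ℕ → Set
Starless {K} χ M = ∀ x y (f : Fin M → Fin K) → Injective _≡_ _≡_ f →
  ¬ (∀ j → χ x (f j) ≡ χ x y ⊎ χ y (f j) ≡ χ x y)

-- The colouring of a graph with few big vertices.

module Avoid {p K : ℕ} (q m n : ℕ) (χ : Fin K → Fin K → Fin p) (χ-sym : ∀ x y → χ x y ≡ χ y x)
             (1≤q : 1 ≤ q) (q≤1+p : q ≤ 1 + p) (m≤n : m ≤ n) (G : Graph)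
             (few-big : count (λ v → suc (q * m) ≤? degree (edges G) v) (allFin (order G)) ≤ K) where

  Small Big : Vertex G → Set
  Small v = degree (edges G) v ≤ q * m
  Big v   = q * m < degree (edges G) v

  big? : Decidable Big
  big? v = suc (q * m) ≤? degree (edges G) v

  bigs : List (Vertex G)
  bigs = filter big? (allFin (order G))

  bigs≤K : length bigs ≤ K
  bigs≤K = ≤-trans (≤-reflexive (length-filter big? (allFin (order G)))) few-big

  ∈-bigs : ∀ v → Big v → v ∈ bigs
  ∈-bigs v = ∈-filter⁺ big? (∈-allFin v)

  -- Identifies big vertices with points of `χ`; there are at most K of them.
  rank : ∀ v → Big v → Fin K
  rank v b = inject≤ (index (∈-bigs v b)) bigs≤K

  rank-injective : ∀ u v (b : Big u) (b′ : Big v) → rank u b ≡ rank v b′ → u ≡ v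
  rank-injective u v b b′ eq = index-injective (setoid _) (∈-bigs u b) (∈-bigs v b′)
    (Fin.inject≤-injective bigs≤K bigs≤K _ _ eq)

  open Greedy p q m {Small} (λ v → degree (edges G) v ≤? q * m) 1≤q q≤1+p

  greedyColour : Vertex G × Vertex G → Fin (p + q)
  greedyColour = proj₁ (greedy (edges! G) (λ small → small))

  greedy-good : Good greedyColour (edges G)
  greedy-good = proj₂ (greedy (edges! G) (λ small → small))

  -- The two decisions are arguments so that proofs can split on them.
  mix : ∀ u v → Dec (Big u) → Dec (Big v) → Fin (p + q)
  mix u v (yes b) (yes b′) = χ (rank u b) (rank v b′) ↑ˡ q
  mix u v (yes _) (no _)   = greedyColour (ordered u v)
  mix u v (no _)  _        = greedyColour (ordered u v)

  mix-sym : ∀ u v d d′ → mix u v d d′ ≡ mix v u d′ d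
  mix-sym u v (yes b) (yes b′) = cong (_↑ˡ q) (χ-sym (rank u b) (rank v b′))
  mix-sym u v (yes _) (no _)   = cong greedyColour (ordered-sym u v)
  mix-sym u v (no _)  (yes _)  = cong greedyColour (ordered-sym u v)
  mix-sym u v (no _)  (no _)   = cong greedyColour (ordered-sym u v)

  colouring : EdgeColouring (p + q) G
  colouring = record
    { colour     = λ u v _ → mix u v (big? u) (big? v)
    ; colour-sym = λ u v _ _ → mix-sym u v (big? u) (big? v)
    }

  mix-big : ∀ u v (b : Big u) (b′ : Big v) →
            mix u v (big? u) (big? v) ≡ χ (rank u b) (rank v b′) ↑ˡ q
  mix-big u v b b′ with big? u | big? v
  ... | no ¬b | _      = contradiction b ¬b
  ... | yes _ | no ¬b′ = contradiction b′ ¬b′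
  ... | yes c | yes c′ = cong₂ (λ c c′ → χ (rank u c) (rank v c′) ↑ˡ q)
                               (≤-irrelevant c b) (≤-irrelevant c′ b′)

  mix-smallˡ : ∀ u v → Small u → mix u v (big? u) (big? v) ≡ greedyColour (ordered u v)
  mix-smallˡ u v small with big? u
  ... | yes b = contradiction small (<⇒≱ b)
  ... | no  _ = refl

  -- The edge keeps its greedy colour, and having a big end, it is admissible only with one of the
  -- last q colours.
  mix-big-small : ∀ u v → Adj G u v → Big u → Small v →
                  ∃ λ j → mix u v (big? u) (big? v) ≡ p ↑ʳ j
  mix-big-small u v e big small =
    let j , eq = upper (ordered u v) _ (ordered-cases u v) adm in j , trans mix≡ eq
    where
    mix≡ : mix u v (big? u) (big? v) ≡ greedyColour (ordered u v)
    mix≡ = trans (mix-sym u v (big? u) (big? v))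
                 (trans (mix-smallˡ v u small) (cong greedyColour (ordered-sym v u)))
    adm : Admissible (ordered u v) (greedyColour (ordered u v))
    adm = proj₂ greedy-good (∈-edges⁺ G e)
    upper : ∀ f c → f ≡ (u , v) ⊎ f ≡ (v , u) → Admissible f c → ∃ λ j → c ≡ p ↑ʳ j
    upper f c _           (inj₂ (j , eq))      = j , eq
    upper f c (inj₁ refl) (inj₁ (small-u , _)) = contradiction small-u (<⇒≱ big)
    upper f c (inj₂ refl) (inj₁ (_ , small-u)) = contradiction small-u (<⇒≱ big)

  -- All edges at a small vertex keep their greedy colours, of which each occurs there at most m
  -- times. Distinct neighbours give distinct edges.
  few-neighbours : ∀ u {i k} (f : Fin k → Vertex G) → Injective _≡_ _≡_ f → Small u →
                   (∀ j → Adj G u (f j) × mix u (f j) (big? u) (big? (f j)) ≡ i) → k ≤ m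
  few-neighbours u {i} f f-inj small f-adj = ≤-trans
    (injection⇒≤count (λ e → u ∈ᵉ? e ×-dec greedyColour e Fin.≟ i) (λ j → ordered u (f j))
      inj (λ j → ∈-edges⁺ G (proj₁ (f-adj j)))
      (λ j → ∈ᵉ-ordered u (f j) , trans (sym (mix-smallˡ u (f j) small)) (proj₂ (f-adj j))))
    (proj₁ greedy-good {u} small i)
    where
    inj : Injective _≡_ _≡_ (λ j → ordered u (f j))
    inj eq with ordered-injective eq
    ... | inj₁ (_ , fj≡fk)   = f-inj fj≡fk
    ... | inj₂ (u≡fk , fj≡u) = f-inj (trans fj≡u u≡fk)

  no-copy : Starless χ ((1 + n) + (1 + m)) → ¬ MonochromaticCopy colouring (doubleStar n m)
  no-copy starless copy = starless (rank (at c₁) big₁) (rank (at c₂) big₂) (λ v → rank (embed v) (big v))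
    (λ {u} {v} eq → embed-inj (rank-injective (embed u) (embed v) (big u) (big v) eq)) near
    where
    open MonochromaticCopy copy
    Node : Set
    Node = Fin (1 + n) ⊎ Fin (1 + m)
    at : Node → Vertex G
    at s = embed (node s)
    at-inj : Injective _≡_ _≡_ at
    at-inj = node-injective ∘ embed-inj
    at-edge : ∀ s t → T (doubleStarAdj s t) →
              Adj G (at s) (at t) × mix (at s) (at t) (big? (at s)) (big? (at t)) ≡ copyColour
    at-edge s t st = embed-edge (node s) (node t) (node-Adj s t st)
    big-centre : ∀ {k} s (h : Fin k → Node) → Injective _≡_ _≡_ h →
                 (∀ j → T (doubleStarAdj s (h j))) → m < k → Big (at s)
    big-centre s h h-inj s-h m<k = ≰⇒> λ small →
      <⇒≱ m<k (few-neighbours (at s) (at ∘ h) (h-inj ∘ at-inj) small (λ j → at-edge s (h j) (s-h j)))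
    c₁ c₂ : Node
    c₁ = inj₁ zero
    c₂ = inj₂ zero
    around₁ : Fin (1 + n) → Node
    around₁ zero    = c₂
    around₁ (suc j) = inj₁ (suc j)
    around₂ : Fin (1 + m) → Node
    around₂ zero    = c₁
    around₂ (suc j) = inj₂ (suc j)
    -- Counting the other centre, the centres have n + 1 and m + 1 neighbours in the copy, both more
    -- than m and thus too many for a small vertex.
    big₁ : Big (at c₁)
    big₁ = big-centre c₁ around₁
      (λ { {zero} {zero} _ → refl ; {suc _} {suc _} refl → refl })
      (λ { zero → tt ; (suc _) → tt }) (s≤s m≤n)
    big₂ : Big (at c₂)
    big₂ = big-centre c₂ around₂
      (λ { {zero} {zero} _ → refl ; {suc _} {suc _} refl → refl })
      (λ { zero → tt ; (suc _) → tt }) ≤-refl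
    i = χ (rank (at c₁) big₁) (rank (at c₂) big₂)
    copyColour≡ : copyColour ≡ i ↑ˡ q
    copyColour≡ = trans (sym (proj₂ (at-edge c₁ c₂ tt))) (mix-big (at c₁) (at c₂) big₁ big₂)
    -- The copy has one of the first p colours, as its central edge joins big vertices. An edge from
    -- a big to a small vertex would have one of the last q.
    spread : ∀ s t → T (doubleStarAdj s t) → Big (at s) → Big (at t)
    spread s t st big-s = ≰⇒> λ small →
      let j , eq = mix-big-small (at s) (at t) (proj₁ (at-edge s t st)) big-s small
      in ↑ˡ≢↑ʳ (trans (sym copyColour≡) (trans (sym (proj₂ (at-edge s t st))) eq))
    dominated : ∀ s → T (doubleStarAdj c₁ s) ⊎ T (doubleStarAdj c₂ s)
    dominated (inj₁ zero)    = inj₂ tt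
    dominated (inj₁ (suc _)) = inj₁ tt
    dominated (inj₂ zero)    = inj₁ tt
    dominated (inj₂ (suc _)) = inj₂ tt
    dominated′ : ∀ v → (Adj (doubleStar n m) (node c₁) v) ⊎ (Adj (doubleStar n m) (node c₂) v)
    dominated′ v with dominated (splitAt (1 + n) v)
    ... | inj₁ e = inj₁ (subst (Adj (doubleStar n m) (node c₁)) (Fin.join-splitAt (1 + n) (1 + m) v)
                               (node-Adj c₁ (splitAt (1 + n) v) e))
    ... | inj₂ e = inj₂ (subst (Adj (doubleStar n m) (node c₂)) (Fin.join-splitAt (1 + n) (1 + m) v)
                               (node-Adj c₂ (splitAt (1 + n) v) e))
    -- Every leaf is adjacent to a centre, and the centres to each other, so bigness spreads to the
    -- whole copy.
    big : ∀ v → Big (embed v)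
    big v = subst (λ v → Big (embed v)) (Fin.join-splitAt (1 + n) (1 + m) v)
      (big-node (splitAt (1 + n) v))
      where
      big-node : ∀ s → Big (at s)
      big-node s with dominated s
      ... | inj₁ e = spread c₁ s e big₁
      ... | inj₂ e = spread c₂ s e big₂
    same : ∀ c v (b : Big (embed c)) → Adj (doubleStar n m) c v → χ (rank (embed c) b) (rank (embed v) (big v)) ≡ i
    same c v b e = Fin.↑ˡ-injective q _ _
      (trans (sym (mix-big (embed c) (embed v) b (big v))) (trans (proj₂ (embed-edge c v e)) copyColour≡))
    near : ∀ v → χ (rank (at c₁) big₁) (rank (embed v) (big v)) ≡ i ⊎ χ (rank (at c₂) big₂) (rank (embed v) (big v)) ≡ i
    near v = Sum.map (same (node c₁) v big₁) (same (node c₂) v big₂) (dominated′ v)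

-- With fewer edges, `count-degree≥` would allow at most K big vertices, and `colouring` would
-- contain no copy.
lowerBound : ∀ {p K} q m n (χ : Fin K → Fin K → Fin p) → (∀ x y → χ x y ≡ χ y x) →
             Starless χ ((1 + n) + (1 + m)) → 1 ≤ q → q ≤ 1 + p → m ≤ n →
             ∀ G → Arrows (p + q) G (doubleStar n m) → suc K * suc (q * m) ≤ 2 * size G
lowerBound {p} {K} q m n χ χ-sym starless 1≤q q≤1+p m≤n G G→H with suc K * suc (q * m) ≤? 2 * size G
... | yes bound = bound
... | no ¬bound = contradiction (G→H colouring) (no-copy starless)
  where
  few-big : count (λ v → suc (q * m) ≤? degree (edges G) v) (allFin (order G)) ≤ K
  few-big = s≤s⁻¹ (*-cancelʳ-< (suc (q * m)) _ _
    (≤-<-trans (count-degree≥ G (suc (q * m))) (≰⇒> ¬bound)))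
  open Avoid q m n χ χ-sym 1≤q q≤1+p m≤n G few-big

-- Cancellation modulo d and the round-robin colouring.

%-cancelˡ-+ : ∀ k {x y d} .{{_ : NonZero d}} → k ≤ d → x < d → y < d →
              (k + x) % d ≡ (k + y) % d → x ≡ y
%-cancelˡ-+ k {x} {y} {d} k≤d x<d y<d eq = begin
  x                                    ≡⟨ shift x x<d ⟨
  ((k + x) % d + (d ∸ k) % d) % d      ≡⟨ cong (λ z → (z + (d ∸ k) % d) % d) eq ⟩
  ((k + y) % d + (d ∸ k) % d) % d      ≡⟨ shift y y<d ⟩
  y                                    ∎
  where
  open ≡-Reasoning
  -- Adding `d ∸ k` undoes the addition of `k` modulo `d`.
  shift : ∀ z → z < d → ((k + z) % d + (d ∸ k) % d) % d ≡ z
  shift z z<d = begin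
    ((k + z) % d + (d ∸ k) % d) % d    ≡⟨ %-distribˡ-+ (k + z) (d ∸ k) d ⟨
    (k + z + (d ∸ k)) % d              ≡⟨ cong (λ w → (w + (d ∸ k)) % d) (+-comm k z) ⟩
    (z + k + (d ∸ k)) % d              ≡⟨ cong (_% d) (+-assoc z k (d ∸ k)) ⟩
    (z + (k + (d ∸ k))) % d            ≡⟨ cong (λ w → (z + w) % d) (m+[n∸m]≡n k≤d) ⟩
    (z + d) % d                        ≡⟨ [m+n]%n≡m%n z d ⟩
    z % d                              ≡⟨ m<n⇒m%n≡m z<d ⟩
    z                                  ∎

-- 1 + t is the inverse of 2 modulo 1 + 2 t.
%-cancel-double : ∀ t {x y} → x < suc (2 * t) → y < suc (2 * t) →
                  (x + x) % suc (2 * t) ≡ (y + y) % suc (2 * t) → x ≡ y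
%-cancel-double t {x} {y} x<d y<d eq = begin
  x                                ≡⟨ halve x x<d ⟨
  ((x + x) % d * (suc t % d)) % d  ≡⟨ cong (λ z → (z * (suc t % d)) % d) eq ⟩
  ((y + y) % d * (suc t % d)) % d  ≡⟨ halve y y<d ⟩
  y                                ∎
  where
  open ≡-Reasoning
  d = suc (2 * t)
  double-half : ∀ t z → (z + z) * suc t ≡ z + z * suc (2 * t)
  double-half = solve-∀
  halve : ∀ z → z < d → ((z + z) % d * (suc t % d)) % d ≡ z
  halve z z<d = begin
    ((z + z) % d * (suc t % d)) % d  ≡⟨ %-distribˡ-* (z + z) (suc t) d ⟨
    ((z + z) * suc t) % d            ≡⟨ cong (_% d) (double-half t z) ⟩
    (z + z * d) % d                  ≡⟨ [m+kn]%n≡m%n z z d ⟩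
    z % d                            ≡⟨ m<n⇒m%n≡m z<d ⟩
    z                                ∎

-- The round-robin 1-factorisation of the complete graph on ℤ/(1 + 2t) ∪ {∞},
-- with ∞ as zero. Every part also gets a colour for the edges inside it, equal
-- to the colour of some edge leaving the part.
module RoundRobin (t : ℕ) where

  _⊕_ : Fin (suc (2 * t)) → Fin (suc (2 * t)) → Fin (suc (2 * t))
  a ⊕ b = (toℕ a + toℕ b) mod suc (2 * t)

  toℕ-⊕ : ∀ a b → toℕ (a ⊕ b) ≡ (toℕ a + toℕ b) % suc (2 * t)
  toℕ-⊕ a b = Fin.toℕ-fromℕ< _

  ⊕-comm : ∀ a b → a ⊕ b ≡ b ⊕ a
  ⊕-comm a b = cong (_mod suc (2 * t)) (+-comm (toℕ a) (toℕ b))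

  ⊕-cancelˡ : ∀ a {b c} → a ⊕ b ≡ a ⊕ c → b ≡ c
  ⊕-cancelˡ a {b} {c} eq = Fin.toℕ-injective
    (%-cancelˡ-+ (toℕ a) (<⇒≤ (Fin.toℕ<n a)) (Fin.toℕ<n b) (Fin.toℕ<n c)
      (trans (sym (toℕ-⊕ a b)) (trans (cong toℕ eq) (toℕ-⊕ a c))))

  ⊕-cancel-double : ∀ {a b} → a ⊕ a ≡ b ⊕ b → a ≡ b
  ⊕-cancel-double {a} {b} eq = Fin.toℕ-injective
    (%-cancel-double t (Fin.toℕ<n a) (Fin.toℕ<n b)
      (trans (sym (toℕ-⊕ a a)) (trans (cong toℕ eq) (toℕ-⊕ b b))))

  Part : Set
  Part = Fin (suc (suc (2 * t)))

  π : Part → Part → Fin (suc (2 * t))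
  π zero    zero    = zero ⊕ zero
  π zero    (suc b) = b ⊕ b
  π (suc a) zero    = a ⊕ a
  π (suc a) (suc b) = a ⊕ b

  π-sym : ∀ a b → π a b ≡ π b a
  π-sym zero    zero    = refl
  π-sym zero    (suc b) = refl
  π-sym (suc a) zero    = refl
  π-sym (suc a) (suc b) = ⊕-comm a b

  -- If a and b differ, their colour matches them with each other, so c = b. If they coincide, c is
  -- the part at the other end of the edge whose colour is used inside a: ∞ for a finite part, and 0
  -- for ∞.
  two-parts : ∀ a b → ∃ λ c → ∀ d → π a d ≡ π a b ⊎ π b d ≡ π a b → d ≡ a ⊎ d ≡ c
  two-parts zero    zero    = suc zero , λ where
    zero    _         → inj₁ refl
    (suc d) (inj₁ eq) → inj₂ (cong suc (⊕-cancel-double eq))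
    (suc d) (inj₂ eq) → inj₂ (cong suc (⊕-cancel-double eq))
  two-parts zero    (suc b) = suc b , λ where
    zero    _         → inj₁ refl
    (suc d) (inj₁ eq) → inj₂ (cong suc (⊕-cancel-double eq))
    (suc d) (inj₂ eq) → inj₂ (cong suc (⊕-cancelˡ b eq))
  two-parts (suc a) zero    = zero , λ where
    zero    _         → inj₂ refl
    (suc d) (inj₁ eq) → inj₁ (cong suc (⊕-cancelˡ a eq))
    (suc d) (inj₂ eq) → inj₁ (cong suc (⊕-cancel-double eq))
  two-parts (suc a) (suc b) with a Fin.≟ b
  ... | yes refl = zero , λ where
    zero    _         → inj₂ refl
    (suc d) (inj₁ eq) → inj₁ (cong suc (⊕-cancelˡ a eq))
    (suc d) (inj₂ eq) → inj₁ (cong suc (⊕-cancelˡ a eq))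
  ... | no a≢b = suc b , λ where
    zero    (inj₁ eq) → contradiction (⊕-cancelˡ a eq) a≢b
    zero    (inj₂ eq) → contradiction (⊕-cancelˡ b (trans (⊕-comm b a) (sym eq))) a≢b
    (suc d) (inj₁ eq) → inj₂ (cong suc (⊕-cancelˡ a eq))
    (suc d) (inj₂ eq) → inj₁ (cong suc (⊕-cancelˡ b (trans eq (⊕-comm a b))))

  module _ (h : ℕ) where

    part : Fin (suc (suc (2 * t)) * h) → Part
    part x = proj₁ (remQuot {suc (suc (2 * t))} h x)

    slot : Fin (suc (suc (2 * t)) * h) → Fin h
    slot x = proj₂ (remQuot {suc (suc (2 * t))} h x)

    part-slot-injective : ∀ {x y} → part x ≡ part y → slot x ≡ slot y → x ≡ y
    part-slot-injective {x} {y} p s =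
      trans (sym (Fin.combine-remQuot {suc (suc (2 * t))} h x))
            (trans (cong₂ combine p s) (Fin.combine-remQuot {suc (suc (2 * t))} h y))

    χ : Fin (suc (suc (2 * t)) * h) → Fin (suc (suc (2 * t)) * h) → Fin (suc (2 * t))
    χ x y = π (part x) (part y)

    χ-sym : ∀ x y → χ x y ≡ χ y x
    χ-sym x y = π-sym (part x) (part y)

    -- By `two-parts` the vertices in question lie in two parts of h slots each, so there are at
    -- most 2 h of them.
    χ-starless : ∀ {M} → 2 * h < M → Starless χ M
    χ-starless {M} 2h<M x y f f-inj near with c , only ← two-parts (part x) (part y) =
      contradiction (Fin.injective⇒≤ (λ {j} {k} → g-inj {j} {k})) (<⇒≱ 2h<M)
      where
      side : ∀ {d} → Dec (d ≡ part x) → Fin 2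
      side (yes _) = zero
      side (no _)  = suc zero
      side-inj : ∀ {d e} (p : Dec (d ≡ part x)) (q : Dec (e ≡ part x)) →
                 d ≡ part x ⊎ d ≡ c → e ≡ part x ⊎ e ≡ c → side p ≡ side q → d ≡ e
      side-inj (yes p) (yes q) _        _        _ = trans p (sym q)
      side-inj (no ¬p) (no ¬q) (inj₁ p) _        _ = contradiction p ¬p
      side-inj (no ¬p) (no ¬q) (inj₂ _) (inj₁ q) _ = contradiction q ¬q
      side-inj (no ¬p) (no ¬q) (inj₂ p) (inj₂ q) _ = trans p (sym q)
      g : Fin M → Fin (2 * h)
      g j = combine (side (part (f j) Fin.≟ part x)) (slot (f j))
      g-inj : Injective _≡_ _≡_ g
      g-inj {j} {k} eq with side≡ , slot≡ ← Fin.combine-injective _ _ _ _ eq =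
        f-inj (part-slot-injective
          (side-inj (part (f j) Fin.≟ part x) (part (f k) Fin.≟ part x)
                    (only _ (near j)) (only _ (near k)) side≡)
          slot≡)

-- Choice of parameters for given r.

halves : ∀ k → ∃ λ h → 2 * h ≤ k × k ≤ suc (2 * h)
halves zero          = 0 , z≤n , z≤n
halves (suc zero)    = 0 , z≤n , s≤s z≤n
halves (suc (suc k)) with h , lo , hi ← halves k =
  suc h , ≤-trans (≤-reflexive (double-suc h)) (s≤s (s≤s lo)) ,
  ≤-trans (s≤s (s≤s hi)) (≤-reflexive (cong suc (sym (double-suc h))))
  where
  double-suc : ∀ h → 2 * suc h ≡ suc (suc (2 * h))
  double-suc = solve-∀

n+m+2≤2+2h : ∀ n m {h} → n + suc m ≤ suc (2 * h) → n + m + 2 ≤ 2 * suc h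
n+m+2≤2+2h n m {h} ≤1+2h = begin
  n + m + 2          ≡⟨ rearrange n m ⟩
  suc (n + suc m)    ≤⟨ s≤s ≤1+2h ⟩
  suc (suc (2 * h))  ≡⟨ *-suc 2 h ⟨
  2 * suc h          ∎
  where
  open ≤-Reasoning
  rearrange : ∀ n m → n + m + 2 ≡ suc (n + suc m)
  rearrange = solve-∀

-- One colour serves for the edges between big vertices and one for the rest. With K = n + m + 1,
-- the big vertices are too few to contain a copy.
lowerBound₂ : ∀ n m → m ≤ n → ∀ G → Arrows 2 G (doubleStar n m) → (m + 1) * (n + m + 2) ≤ 2 * size G
lowerBound₂ n m m≤n G G→H = ≤-trans (≤-reflexive (rearrange n m))
  (lowerBound {1} {n + suc m} 1 m n (λ _ _ → zero) (λ _ _ → refl)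
    (λ _ _ f f-inj _ → 1+n≰n (Fin.injective⇒≤ f-inj)) ≤-refl (s≤s z≤n) m≤n G G→H)
  where
  rearrange : ∀ n m → (m + 1) * (n + m + 2) ≡ suc (n + suc m) * suc (1 * m)
  rearrange = solve-∀

-- The lower bound for r = (1 + 2 t) + q, as an inequality in t, q, m and the
-- size h of the parts of the big vertices.
Sufficient : ℕ → ℕ → ℕ → ℕ → ℕ → Set
Sufficient r t q m h =
  (r ^ 2 ∸ 1) * m * suc h ≤ 4 * (suc (suc (suc (2 * t)) * h) * suc (q * m))

-- The factor 16 is 2 · 4 · 2, coming from n + m + 2 ≤ 2 (h + 1), from `Sufficient` and from the
-- degree sum.
sufficient⇒bound : ∀ {r} t q n m h → r ≡ suc (2 * t) + q → 1 ≤ q → q ≤ 2 + 2 * t → m ≤ n →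
  2 * h ≤ n + suc m → n + suc m ≤ suc (2 * h) → Sufficient r t q m h →
  ∀ G → Arrows r G (doubleStar n m) → (r ^ 2 ∸ 1) * m * (n + m + 2) ≤ 16 * size G
sufficient⇒bound t q n m h refl 1≤q q≤ m≤n 2h≤ ≤1+2h suff G G→H = begin
  c * (n + m + 2)        ≤⟨ *-monoʳ-≤ c (n+m+2≤2+2h n m ≤1+2h) ⟩
  c * (2 * suc h)        ≡⟨ swap c (suc h) ⟩
  2 * (c * suc h)        ≤⟨ *-monoʳ-≤ 2 suff ⟩
  2 * (4 * (suc (suc (suc (2 * t)) * h) * suc (q * m)))
    ≤⟨ *-monoʳ-≤ 2 (*-monoʳ-≤ 4
         (lowerBound q m n (χ h) (χ-sym h) (χ-starless h (s≤s 2h≤)) 1≤q q≤ m≤n G G→H)) ⟩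
  2 * (4 * (2 * size G)) ≡⟨ assoc (size G) ⟩
  16 * size G            ∎
  where
  open ≤-Reasoning
  open RoundRobin t
  r = suc (2 * t) + q
  c = (r ^ 2 ∸ 1) * m
  swap : ∀ a b → a * (2 * b) ≡ 2 * (a * b)
  swap = solve-∀
  assoc : ∀ a → 2 * (4 * (2 * a)) ≡ 16 * a
  assoc = solve-∀

-- Replaces truncated subtraction by a polynomial that the ring solver can handle.
suc²∸1 : ∀ x → suc x ^ 2 ∸ 1 ≡ x * (2 + x)
suc²∸1 x = cong (_∸ 1) (expand x)
  where
  expand : ∀ x → suc x * (suc x * 1) ≡ suc (x * (2 + x))
  expand = solve-∀

sufficient : ∀ x {t q m h} → x * (2 + x) * m * suc h ≤ 4 * (suc (suc (suc (2 * t)) * h) * suc (q * m)) →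
             Sufficient (suc x) t q m h
sufficient x {m = m} {h} = ≤-trans (≤-reflexive (cong (λ c → c * m * suc h) (suc²∸1 x)))

-- With h = 2 t + d, the sides differ by a polynomial in t, m, d with non-negative coefficients, the
-- second summand in `identity`. `sufficient₂` and `sufficient₃` work alike, each from its own lower
-- bound on h.
sufficient₁ : ∀ t m h → 2 * t ≤ h → Sufficient (1 + t * 4) t (2 * t) m h
sufficient₁ t m h 2t≤h = subst (Sufficient (1 + t * 4) t (2 * t) m) (m+[n∸m]≡n 2t≤h)
  (sufficient (t * 4) {t} {2 * t} {m} (m+n≤o⇒m≤o _ (≤-reflexive (identity t m (h ∸ 2 * t)))))
  where
  identity : ∀ t m d →
    t * 4 * (2 + t * 4) * m * suc (2 * t + d) +
      (8 * t * m * d + 8 * (t + 1) * (2 * t + d) + 4) ≡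
    4 * (suc (suc (suc (2 * t)) * (2 * t + d)) * suc (2 * t * m))
  identity = solve-∀

sufficient₂ : ∀ t m h → t * (2 + t) ≤ h → Sufficient (2 + t * 4) t (1 + 2 * t) m h
sufficient₂ t m h ≤h = subst (Sufficient (2 + t * 4) t (1 + 2 * t) m) (m+[n∸m]≡n ≤h)
  (sufficient (1 + t * 4) {t} {1 + 2 * t} {m} (m+n≤o⇒m≤o _ (≤-reflexive (identity t m (h ∸ t * (2 + t))))))
  where
  identity : ∀ t m d →
    (1 + t * 4) * (2 + (1 + t * 4)) * m * suc (t * (2 + t) + d) +
      ((8 * t + 5) * m * d + (8 * t * t * t + 5 * t * t + 2 * t + 1) * m +
       8 * (t + 1) * (t * (2 + t) + d) + 4) ≡
    4 * (suc (suc (suc (2 * t)) * (t * (2 + t) + d)) * suc ((1 + 2 * t) * m))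
  identity = solve-∀

sufficient₃ : ∀ t m h → 2 * t ≤ h → Sufficient (3 + t * 4) t (2 + 2 * t) m h
sufficient₃ t m h 2t≤h = subst (Sufficient (3 + t * 4) t (2 + 2 * t) m) (m+[n∸m]≡n 2t≤h)
  (sufficient (2 + t * 4) {t} {2 + 2 * t} {m} (m+n≤o⇒m≤o _ (≤-reflexive (identity t m (h ∸ 2 * t)))))
  where
  identity : ∀ t m d →
    (2 + t * 4) * (2 + (2 + t * 4)) * m * suc (2 * t + d) +
      (8 * (t + 1) * m * d + 8 * (t + 1) * (2 * t + d) + 4) ≡
    4 * (suc (suc (suc (2 * t)) * (2 * t + d)) * suc ((2 + 2 * t) * m))
  identity = solve-∀

-- The right-hand side contains (16 + 8 u) h without a factor m. Lowering it to (16 + 8 u) m by m ≤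
-- h leaves a comparison with non-negative coefficients in d, where h = (1 + u) (2 + u) + d.
sufficient₀ : ∀ u m h → m ≤ h → (1 + u) * (2 + u) ≤ h →
              Sufficient (suc u * 4) (suc u) (1 + 2 * u) m h
sufficient₀ u m h m≤h ≤h = sufficient (3 + u * 4) {suc u} {1 + 2 * u} {m} (begin
  (3 + u * 4) * (2 + (3 + u * 4)) * m * suc h
    ≡⟨ cong (λ h → (3 + u * 4) * (2 + (3 + u * 4)) * m * suc h) (m+[n∸m]≡n ≤h) ⟨
  (3 + u * 4) * (2 + (3 + u * 4)) * m * suc h′
    ≤⟨ m+n≤o⇒m≤o _ (≤-reflexive (identity u m (h ∸ (1 + u) * (2 + u)))) ⟩
  rest h′ + (16 + 8 * u) * m
    ≡⟨ cong (λ h → rest h + (16 + 8 * u) * m) (m+[n∸m]≡n ≤h) ⟩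
  rest h + (16 + 8 * u) * m
    ≤⟨ +-monoʳ-≤ (rest h) (*-monoʳ-≤ (16 + 8 * u) m≤h) ⟩
  rest h + (16 + 8 * u) * h
    ≡⟨ expand u m h ⟩
  4 * (suc (suc (suc (2 * suc u)) * h) * suc ((1 + 2 * u) * m)) ∎)
  where
  open ≤-Reasoning
  h′ = (1 + u) * (2 + u) + (h ∸ (1 + u) * (2 + u))
  rest : ℕ → ℕ
  rest h = (16 * u * u + 40 * u + 16) * m * h + (4 + 8 * u) * m + 4
  identity : ∀ u m d →
    (3 + u * 4) * (2 + (3 + u * 4)) * m * suc ((1 + u) * (2 + u) + d) +
      ((8 * u * u * u + 9 * u * u + 3 * u + 7) * m + (8 * u + 1) * m * d + 4) ≡
    (16 * u * u + 40 * u + 16) * m * ((1 + u) * (2 + u) + d) + (4 + 8 * u) * m + 4 + (16 + 8 * u) * m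
  identity = solve-∀
  expand : ∀ u m h → (16 * u * u + 40 * u + 16) * m * h + (4 + 8 * u) * m + 4 + (16 + 8 * u) * h ≡
    4 * (suc (suc (suc (2 * suc u)) * h) * suc ((1 + 2 * u) * m))
  expand = solve-∀

⌊4t/2⌋ : ∀ t → ⌊ t * 4 /2⌋ ≡ 2 * t
⌊4t/2⌋ zero    = refl
⌊4t/2⌋ (suc t) = trans (cong (2 +_) (⌊4t/2⌋ t)) (sym (*-suc 2 t))

⌈4t/2⌉ : ∀ t → ⌈ t * 4 /2⌉ ≡ 2 * t
⌈4t/2⌉ zero    = refl
⌈4t/2⌉ (suc t) = trans (cong (2 +_) (⌈4t/2⌉ t)) (sym (*-suc 2 t))

-- The assumption on n + m + 2 as a lower bound on h.

module _ {n m h : ℕ} (r : ℕ) (m≤n : m ≤ n) (≤1+2h : n + suc m ≤ suc (2 * h))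
         (large : (⌈ r /2⌉ + 1) ^ 2 ≤ 2 * (n + m + 2)) where

  m≤half : m ≤ h
  m≤half = s≤s⁻¹ (*-cancelˡ-≤ 2 (begin
    2 * suc m   ≡⟨ double m ⟩
    m + m + 2   ≤⟨ +-monoˡ-≤ 2 (+-monoˡ-≤ m m≤n) ⟩
    n + m + 2   ≤⟨ n+m+2≤2+2h n m ≤1+2h ⟩
    2 * suc h   ∎))
    where
    open ≤-Reasoning
    double : ∀ m → 2 * suc m ≡ m + m + 2
    double = solve-∀

  large-half : ∀ {c} → c ≤ ⌈ r /2⌉ → (c + 1) * (c + 1) ≤ 4 * suc h
  large-half {c} c≤ = begin
    (c + 1) * (c + 1)        ≤⟨ *-mono-≤ (+-monoˡ-≤ 1 c≤) (+-monoˡ-≤ 1 c≤) ⟩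
    (⌈ r /2⌉ + 1) * (⌈ r /2⌉ + 1) ≡⟨ cong ((⌈ r /2⌉ + 1) *_) (*-identityʳ _) ⟨
    (⌈ r /2⌉ + 1) ^ 2        ≤⟨ large ⟩
    2 * (n + m + 2)          ≤⟨ *-monoʳ-≤ 2 (n+m+2≤2+2h n m ≤1+2h) ⟩
    2 * (2 * suc h)          ≡⟨ *-assoc 2 2 (suc h) ⟨
    4 * suc h                ∎
    where open ≤-Reasoning

  -- Here (2 t + 2)² = 4 (1 + t (2 + t)) is at most 4 (1 + h).
  odd-half : ∀ t → 1 + 2 * t ≤ ⌈ r /2⌉ → t * (2 + t) ≤ h
  odd-half t c≤ = s≤s⁻¹ (*-cancelˡ-≤ 4 (≤-trans (≤-reflexive (square t)) (large-half c≤)))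
    where
    square : ∀ t → 4 * suc (t * (2 + t)) ≡ (1 + 2 * t + 1) * (1 + 2 * t + 1)
    square = solve-∀

  -- The odd square (2 u + 3)² is 1 + 4 (1 + u) (2 + u), so cancelling 4 gives the strict inequality
  -- (1 + u) (2 + u) < 1 + h.
  even-half : ∀ u → 2 * suc u ≤ ⌈ r /2⌉ → (1 + u) * (2 + u) ≤ h
  even-half u c≤ = s≤s⁻¹ (*-cancelˡ-< 4 _ _ (≤-trans (≤-reflexive (square u)) (large-half c≤)))
    where
    square : ∀ u → suc (4 * ((1 + u) * (2 + u))) ≡ (2 * suc u + 1) * (2 * suc u + 1)
    square = solve-∀

2t≤t[2+t] : ∀ t → 2 * t ≤ t * (2 + t)
2t≤t[2+t] t = ≤-trans (≤-reflexive (*-comm 2 t)) (*-monoʳ-≤ t (m≤m+n 2 t))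

lowerBound₃ : ∀ r n m → m ≤ n → (⌈ r /2⌉ + 1) ^ 2 ≤ 2 * (n + m + 2) → 3 ≤ r →
  ∀ G → Arrows r G (doubleStar n m) → (r ^ 2 ∸ 1) * m * (n + m + 2) ≤ 16 * size G
-- Parts of size h, half of n + m + 1 rounded down, are the largest for which two have fewer than n
-- + m + 2 vertices. The quotient of r by 4 is t, and q = r - 1 - 2 t.
lowerBound₃ r n m m≤n large 3≤r with h , 2h≤ , ≤1+2h ← halves (n + suc m) | r divMod 4
... | result zero    zero             refl = contradiction 3≤r λ ()
... | result (suc u) zero             refl =
  sufficient⇒bound (suc u) (1 + 2 * u) n m h (r≡ u) (s≤s z≤n) (q≤ u) m≤n 2h≤ ≤1+2h
    (sufficient₀ u m h (m≤half (suc u * 4) m≤n ≤1+2h large)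
      (even-half (suc u * 4) m≤n ≤1+2h large u (≤-reflexive (sym (⌈4t/2⌉ (suc u))))))
  where
  r≡ : ∀ u → suc u * 4 ≡ suc (2 * suc u) + (1 + 2 * u)
  r≡ = solve-∀
  q≤ : ∀ u → 1 + 2 * u ≤ 2 + 2 * suc u
  q≤ u = ≤-trans (s≤s (m≤n+m _ 3)) (≤-reflexive (cong (2 +_) (sym (*-suc 2 u))))
... | result zero    (suc zero)       refl = contradiction 3≤r λ { (s≤s ()) }
-- Here q = 2 t, which is positive because r = 1 is excluded.
... | result (suc u) (suc zero)       refl =
  sufficient⇒bound t (2 * t) n m h (r≡ t) (s≤s z≤n) (m≤n+m _ 2) m≤n 2h≤ ≤1+2h
    (sufficient₁ t m h (≤-trans (2t≤t[2+t] t) (odd-half (1 + t * 4) m≤n ≤1+2h large t (≤-reflexive (cong suc (sym (⌊4t/2⌋ t)))))))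
  where
  t = suc u
  r≡ : ∀ t → 1 + t * 4 ≡ suc (2 * t) + 2 * t
  r≡ = solve-∀
... | result t (suc (suc zero))       refl =
  sufficient⇒bound t (1 + 2 * t) n m h (r≡ t) (s≤s z≤n) (n≤1+n _) m≤n 2h≤ ≤1+2h
    (sufficient₂ t m h (odd-half (2 + t * 4) m≤n ≤1+2h large t (≤-reflexive (cong suc (sym (⌈4t/2⌉ t))))))
  where
  r≡ : ∀ t → 2 + t * 4 ≡ suc (2 * t) + (1 + 2 * t)
  r≡ = solve-∀
... | result t (suc (suc (suc zero))) refl =
  sufficient⇒bound t (2 + 2 * t) n m h (r≡ t) (s≤s z≤n) ≤-refl m≤n 2h≤ ≤1+2h
    (sufficient₃ t m h (≤-trans (2t≤t[2+t] t) (odd-half (3 + t * 4) m≤n ≤1+2h large t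
      (≤-trans (n≤1+n _) (≤-reflexive (cong (2 +_) (sym (⌊4t/2⌋ t))))))))
  where
  r≡ : ∀ t → 3 + t * 4 ≡ suc (2 * t) + (2 + 2 * t)
  r≡ = solve-∀

-- Denominators are cleared throughout. By `isSizeRamseyNumber-unique` the number `k` is the
-- size-Ramsey number itself.
theorem1p3 : ∀ (r n m : ℕ) → 2 ≤ r → m ≤ n → 1 ≤ m →
    (⌈ r /2⌉ + 1) ^ 2 ≤ 2 * (n + m + 2) →
    ∃[ k ] ( IsSizeRamseyNumber r (doubleStar n m) k
    × k ≤ 4 * r ^ 2 * n * m + 2 * r * (n + m) + 1
    × (r ≡ 2 → (m + 1) * (n + m + 2) ≤ 2 * k)
    × (3 ≤ r → (r ^ 2 ∸ 1) * m * (n + m + 2) ≤ 16 * k) )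
theorem1p3 r@(suc r′) n m 2≤r m≤n 1≤m large =
  let k , isMin , k≤ = sizeRamseyNumber r′ (doubleStar-noIsolated n m) (upperBound r n m)
  in  k , isMin , k≤ , bound₂ isMin , bound₃ isMin
  where
  bound₂ : ∀ {k} → IsSizeRamseyNumber r (doubleStar n m) k → r ≡ 2 → (m + 1) * (n + m + 2) ≤ 2 * k
  -- The lower bounds hold for every arrowing graph, in particular for one attaining the minimum.
  bound₂ ((G , G→H , refl) , _) refl = lowerBound₂ n m m≤n G G→H
  bound₃ : ∀ {k} → IsSizeRamseyNumber r (doubleStar n m) k → 3 ≤ r →
           (r ^ 2 ∸ 1) * m * (n + m + 2) ≤ 16 * k
  bound₃ ((G , G→H , refl) , _) 3≤r = lowerBound₃ r n m m≤n large 3≤r G G→H
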